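{- Let $f(n)=H_2(n,n)$ for integers $n\geq1$. Then for all integers $n\geq 1$, $$\begin{aligned} &32 (n+1) (2 n+1)^2\bigl(1575 n^6+21285 n^5+117954 n^4+343020 n^3+551943 n^2+465785 n+161046\bigr) f(n)\\ &-8 \bigl(121275 n^9+1933470 n^8+13267683 n^7+51280818 n^6+122556360 n^5+186866686 n^4\\ &\qquad +180574335 n^3+105734340 n^2+33718283 n+4443102\bigr) f(n+1)\\ &+2 \bigl(294525 n^9+4763070 n^8+33170868n^7+130145646 n^6+315713355 n^5+488415476 n^4\\ &\qquad+478464380 n^3+283626704 n^2+91378536 n+12137328\bigr) f(n+2)\\ &+\bigl(294525 n^9+4668570n^8+31877118 n^7+122735586 n^6+292620525 n^5+445804136 n^4\\ &\qquad+431097970 n^3+252913504 n^2+80866406 n+10688508\bigr) f(n+3)\\ &-\bigl(121275n^9+1961820 n^8+13655808 n^7+53503836 n^6+129484209 n^5+199650088 n^4\\ &\qquad+194784258 n^3+114948300 n^2+36871922 n+4877748\bigr) f(n+4)\\ &+2 (2 n+7) \bigl(1575 n^6+11835 n^5+35154 n^4+52554 n^3+41382 n^2+16118 n+2428\bigr) (n+3)^2 f(n+5)=0. \end{aligned}$$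
   Context: For positive integers $r,n,k$, let $H_r(n,k)$ be the number of $n\times k$ arrays of integers (rows indexed $i=1,\dots,n$, columns indexed $j=1,\dots,k$) which obey the following rules: (1) the entry in position $(1,1)$ is $0$, and the entry in position $(n,k)$ is $\max(n,k)-r-1$; (2) the entry in position $(i,j)$ must equal or be one more than each of the entries in positions $(i-1,j)$, $(i,j-1)$, and $(i-1,j-1)$ (whenever those positions exist in the array); (3) the entry in position $(i,j)$ must be within $r$ of $\max(i,j)-1$, i.e. differ from it by at most $r$ in absolute value. (If the rules are contradictory, the count is $0$; for instance $H_2(1,1)=H_2(2,2)=0$.) -}

module Defs where

open import Data.Nat as ℕ using (ℕ; zero; suc; s≤s; _⊔_)
import Data.Nat.Properties as ℕ
open import Data.Integer as ℤ using (ℤ; +_; -[1+_]; 1ℤ; ∣_∣)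
import Data.Integer.Properties as ℤ
open import Data.Fin using (Fin; zero; suc; toℕ)
import Data.Fin.Properties as Finₚ
open import Data.Vec using (Vec; []; _∷_; lookup)
import Data.Vec.Properties as Vec
open import Data.List using (List; []; _∷_; [_]; _++_; map; upTo; length; filter; cartesianProductWith)
open import Data.List.Relation.Unary.All using ([])
open import Data.List.Relation.Unary.Any using (here)
open import Data.List.Relation.Unary.AllPairs using ([]; _∷_)
open import Data.List.Membership.Propositional using (_∈_)
import Data.List.Membership.Propositional.Properties as ∈
open import Data.List.Relation.Unary.Unique.Propositional using (Unique)
import Data.List.Relation.Unary.Unique.Propositional.Properties as Unique
open import Data.Empty using (⊥)
open import Data.Product using (∃; _×_; _,_; proj₂)
open import Data.Sum using (_⊎_)
open import Function using (_⇔_; mk⇔)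
open import Relation.Nullary using (Dec; _×-dec_; _⊎-dec_; _→-dec_)
open import Relation.Nullary.Decidable using (map′)
open import Relation.Binary.PropositionalEquality using (_≡_; refl; cong)

Array : ℕ → ℕ → Set
Array n k = Vec (Vec ℤ k) n

entry : ∀ {n k} → Array n k → Fin n → Fin k → ℤ
entry a i j = lookup (lookup a i) j

-- Rows and columns are numbered from 1.
pos : ∀ {n} → Fin n → ℕ
pos i = suc (toℕ i)

EqualsOrOneMoreThan : ℤ → ℤ → Set
EqualsOrOneMoreThan x y = x ≡ y ⊎ x ≡ y ℤ.+ 1ℤ

-- In `vertical`, `horizontal` and `diagonal`, i′ and j′ are the indices
-- preceding i and j; the rules are void where there is no such index.
record Legal (r n k : ℕ) (a : Array n k) : Set where
  field
    topLeft     : ∀ i j → pos i ≡ 1 → pos j ≡ 1 → entry a i j ≡ + 0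
    bottomRight : ∀ i j → pos i ≡ n → pos j ≡ k →
                  entry a i j ≡ + (n ⊔ k) ℤ.- + r ℤ.- 1ℤ
    vertical    : ∀ i i′ j → pos i ≡ suc (pos i′) →
                  EqualsOrOneMoreThan (entry a i j) (entry a i′ j)
    horizontal  : ∀ i j j′ → pos j ≡ suc (pos j′) →
                  EqualsOrOneMoreThan (entry a i j) (entry a i j′)
    diagonal    : ∀ i i′ j j′ → pos i ≡ suc (pos i′) → pos j ≡ suc (pos j′) →
                  EqualsOrOneMoreThan (entry a i j) (entry a i′ j′)
    near        : ∀ i j →
                  ∣ entry a i j ℤ.- (+ (pos i ⊔ pos j) ℤ.- 1ℤ) ∣ ℕ.≤ r

equalsOrOneMoreThan? : ∀ x y → Dec (EqualsOrOneMoreThan x y)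
equalsOrOneMoreThan? x y = (x ℤ.≟ y) ⊎-dec (x ℤ.≟ y ℤ.+ 1ℤ)

legal? : ∀ r n k (a : Array n k) → Dec (Legal r n k a)
legal? r n k a =
  map′ (λ { (p , q , v , h , d , c) → record
            { topLeft = p ; bottomRight = q ; vertical = v
            ; horizontal = h ; diagonal = d ; near = c } })
       (λ l → let open Legal l in
              topLeft , bottomRight , vertical , horizontal , diagonal , near)
  ( (Finₚ.all? λ i → Finₚ.all? λ j →
       (pos i ℕ.≟ 1) →-dec (pos j ℕ.≟ 1) →-dec (entry a i j ℤ.≟ + 0))
  ×-dec
    (Finₚ.all? λ i → Finₚ.all? λ j →
       (pos i ℕ.≟ n) →-dec (pos j ℕ.≟ k) →-dec
       (entry a i j ℤ.≟ + (n ⊔ k) ℤ.- + r ℤ.- 1ℤ))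
  ×-dec
    (Finₚ.all? λ i → Finₚ.all? λ i′ → Finₚ.all? λ j →
       (pos i ℕ.≟ suc (pos i′)) →-dec
       equalsOrOneMoreThan? (entry a i j) (entry a i′ j))
  ×-dec
    (Finₚ.all? λ i → Finₚ.all? λ j → Finₚ.all? λ j′ →
       (pos j ℕ.≟ suc (pos j′)) →-dec
       equalsOrOneMoreThan? (entry a i j) (entry a i j′))
  ×-dec
    (Finₚ.all? λ i → Finₚ.all? λ i′ → Finₚ.all? λ j → Finₚ.all? λ j′ →
       (pos i ℕ.≟ suc (pos i′)) →-dec (pos j ℕ.≟ suc (pos j′)) →-dec
       equalsOrOneMoreThan? (entry a i j) (entry a i′ j′))
  ×-dec
    (Finₚ.all? λ i → Finₚ.all? λ j →
       ∣ entry a i j ℤ.- (+ (pos i ⊔ pos j) ℤ.- 1ℤ) ∣ ℕ.≤? r))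

-- The integers of absolute value at most b.
interval : ℕ → List ℤ
interval b = map +_ (upTo (suc b)) ++ map -[1+_] (upTo b)

vectors : ∀ {A : Set} → List A → ∀ n → List (Vec A n)
vectors xs zero    = [ [] ]
vectors xs (suc n) = cartesianProductWith _∷_ xs (vectors xs n)

-- The bound on the entries loses nothing, since it follows from `near`; see
-- ∈-legalArrays.
legalArrays : ∀ r n k → List (Array n k)
legalArrays r n k =
  filter (legal? r n k) (vectors (vectors (interval ((n ⊔ k) ℕ.+ r)) k) n)

-- Meaningful for positive r, n and k only.
H : ℕ → ℕ → ℕ → ℕ
H r n k = length (legalArrays r n k)

f : ℕ → ℕ
f n = H 2 n n

-- H r n k is the number of legal arrays: legalArrays lists each of them
-- (∈-legalArrays) exactly once (legalArrays-unique).

∈-interval : ∀ {b} x → ∣ x ∣ ℕ.≤ b → x ∈ interval b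
∈-interval (+ m)    m≤b = ∈.∈-++⁺ˡ (∈.∈-map⁺ +_ (∈.∈-upTo⁺ (s≤s m≤b)))
∈-interval {b} -[1+ m ] m<b =
  ∈.∈-++⁺ʳ (map +_ (upTo (suc b))) (∈.∈-map⁺ -[1+_] (∈.∈-upTo⁺ m<b))

interval-unique : ∀ b → Unique (interval b)
interval-unique b =
  Unique.++⁺ (Unique.map⁺ ℤ.+-injective (Unique.upTo⁺ (suc b)))
             (Unique.map⁺ ℤ.-[1+-injective (Unique.upTo⁺ b))
             λ { (p , q) → disjoint (∈.∈-map⁻ +_ p) (∈.∈-map⁻ -[1+_] q) }
  where
  disjoint : ∀ {x : ℤ} {ms ns} → (∃ λ m → m ∈ ms × x ≡ + m) →
             (∃ λ m → m ∈ ns × x ≡ -[1+ m ]) → ⊥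
  disjoint (_ , _ , refl) (_ , _ , ())

∈-vectors : ∀ {A : Set} {xs : List A} {n} (v : Vec A n) →
            (∀ i → lookup v i ∈ xs) → v ∈ vectors xs n
∈-vectors []      _ = here refl
∈-vectors (x ∷ v) p =
  ∈.∈-cartesianProductWith⁺ _∷_ (p zero) (∈-vectors v (λ i → p (suc i)))

vectors-unique : ∀ {A : Set} {xs : List A} → Unique xs → ∀ n → Unique (vectors xs n)
vectors-unique _ zero    = [] ∷ []
vectors-unique u (suc n) =
  Unique.cartesianProductWith⁺ _∷_ Vec.∷-injective u (vectors-unique u n)

legal⇒bounded : ∀ {r n k a} → Legal r n k a →
                ∀ i j → ∣ entry a i j ∣ ℕ.≤ (n ⊔ k) ℕ.+ r
legal⇒bounded {r} {n} {k} {a} l i j = begin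
  ∣ x ∣                        ≡⟨ cong ∣_∣ (x≡c+[x-c] x c) ⟩
  ∣ c ℤ.+ (x ℤ.- c) ∣          ≤⟨ ℤ.∣i+j∣≤∣i∣+∣j∣ c (x ℤ.- c) ⟩
  ∣ c ∣ ℕ.+ ∣ x ℤ.- c ∣        ≤⟨ ℕ.+-mono-≤ c≤ (Legal.near l i j) ⟩
  (n ⊔ k) ℕ.+ r                ∎
  where
  open ℕ.≤-Reasoning
  open import Data.Integer.Solver using (module +-*-Solver)
  open +-*-Solver using (solve; _:=_; _:+_; _:-_)
  x c : ℤ
  x = entry a i j
  c = + (pos i ⊔ pos j) ℤ.- 1ℤ
  x≡c+[x-c] : ∀ x c → x ≡ c ℤ.+ (x ℤ.- c)
  x≡c+[x-c] = solve 2 (λ x c → x := c :+ (x :- c)) refl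
  c≤ : ∣ c ∣ ℕ.≤ n ⊔ k
  c≤ = ℕ.≤-trans (ℕ.n≤1+n _) (ℕ.⊔-mono-≤ (Finₚ.toℕ<n i) (Finₚ.toℕ<n j))

∈-legalArrays : ∀ r n k (a : Array n k) → a ∈ legalArrays r n k ⇔ Legal r n k a
∈-legalArrays r n k a = mk⇔
  (λ p → proj₂ (∈.∈-filter⁻ (legal? r n k)
                  {xs = vectors (vectors (interval ((n ⊔ k) ℕ.+ r)) k) n} p))
  (λ l → ∈.∈-filter⁺ (legal? r n k)
           (∈-vectors a λ i → ∈-vectors (lookup a i) λ j →
              ∈-interval (entry a i j) (legal⇒bounded l i j))
           l)

legalArrays-unique : ∀ r n k → Unique (legalArrays r n k)
legalArrays-unique r n k = Unique.filter⁺ (legal? r n k)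
  (vectors-unique (vectors-unique (interval-unique ((n ⊔ k) ℕ.+ r)) k) n)

{-# OPTIONS --safe #-}
-- Write the entries of a legal array as max(i, j) − 1 − d(i, j) with d(i, j) ∈ {0, 1, 2}. The
-- rules say that d grows by 0 or 1 along rows, columns and diagonals, suitably oriented, and
-- they constrain the triangles on either side of the diagonal separately. A column of the
-- lower triangle is thus given by the two rows where d reaches 1 and 2, and a triangle by
-- two nonintersecting lattice paths, whose distance performs a simple walk that stays
-- positive. Counting these walks by reflection shows that f(n) is the sum of T(a, b)² over
-- 0 ≤ b < a ≤ n − 2, where T(a, b) is the sum of (a + b choose k) over b < k ≤ a. Since
-- T(a + 1, b) = 2 T(a, b) + (a + b + 1 choose b), the sums of T(a, b)², of
-- T(a, b) (a + b + 1 choose b) and of (a + b + 1 choose b)² over b form a triangular system of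
-- first-order recurrences driven by the squares of the Catalan numbers, whose elimination
-- yields the recurrence for f.
module Submission where

open import Defs
open import Data.Nat as ℕ using (ℕ; zero; suc; s≤s; z≤n; _⊔_)
import Data.Nat.Properties as ℕ
open import Data.Nat.ListAction using (sum)
open import Data.Nat.ListAction.Properties using (sum-++)
import Data.Nat.Tactic.RingSolver as ℕ-Solver
open import Data.Integer as ℤ using (ℤ; +_; 0ℤ; 1ℤ; +≤+)
import Data.Integer.Properties as ℤ
open import Data.Integer.Tactic.RingSolver using (solve-∀)
open import Data.Integer.Solver using (module +-*-Solver)
open import Data.Fin using (Fin; zero; suc; toℕ; fromℕ; inject₁)
import Data.Fin.Properties as Fin
open import Data.Vec as Vec using (Vec; []; _∷_; lookup; tabulate)
import Data.Vec.Properties as Vec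
open import Data.List using (List; []; _∷_; _++_; map; cartesianProduct; concatMap; filter; length)
open import Data.List.Properties using (map-++; map-∘; length-map)
open import Data.List.Membership.Propositional using (_∈_; find; lose)
import Data.List.Membership.Propositional.Properties as ∈
open import Data.List.Membership.Propositional.Properties.WithK using (unique∧set⇒bag)
open import Data.List.Relation.Unary.Any using (here; there)
open import Data.List.Relation.Unary.All as All using (All; []; _∷_)
import Data.List.Relation.Unary.All.Properties as All
open import Data.List.Relation.Unary.AllPairs as AllPairs using ([]; _∷_)
import Data.List.Relation.Unary.AllPairs.Properties as AllPairs
open import Data.List.Relation.Unary.Unique.Propositional using (Unique)
import Data.List.Relation.Unary.Unique.Propositional.Properties as Unique
open import Data.List.Relation.Binary.Disjoint.Propositional using (Disjoint)
open import Data.List.Relation.Binary.BagAndSetEquality using (∼bag⇒↭)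
open import Data.List.Relation.Binary.Permutation.Propositional.Properties using (↭-length)
open import Data.Product using (_×_; _,_; ∃; proj₁; proj₂)
open import Data.Sum using (_⊎_; inj₁; inj₂)
open import Data.Empty using (⊥-elim)
open import Function using (flip; _∘_; _⇔_; mk⇔)
open import Function.Construct.Composition using (_⇔-∘_)
open import Relation.Nullary using (yes; no)
open import Relation.Unary using (Decidable)
open import Relation.Binary.PropositionalEquality
open ≡-Reasoning

-- The bottom row of d is constantly 2, so a finite column can be continued by 2s to an infinite
-- word. The relation between neighbouring columns then no longer depends on the size of the array,
-- and f counts paths in one fixed transition graph, from (`w₂`, `w₂`) to a pair of words with
-- diagonal letter 0. The two triangles meet only on the diagonal; once that is fixed they are
-- filled independently and in equally many ways, whence the squares. In T(a, b), exactly a + 1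
-- diagonal entries have d ≤ 1 and b + 1 of them have d = 0. The sums over b are never evaluated. A
-- suitable combination of the summands for a and a + 1 telescopes in b, and what remains at the
-- boundary is a multiple of a single squared Catalan number. The five sequences `S`, `P`, `Q`, `R`,
-- `Y` satisfy one first-order recurrence each, which accounts for the order five of the result. The
-- elimination itself is replaced by a certificate: explicit polynomial multipliers and one
-- polynomial identity.

-- The unqualified arithmetic operations are those of ℤ in this module and those of ℕ in
-- the theorem.
module Proof where

  open import Data.Integer using (-_; _+_; _-_; _*_)
  open +-*-Solver using (Polynomial; con; var; _:+_; _:*_; _:-_; :-_; _:^_; _:=_; solve; ⟦_⟧)

  -- The lattice sums

  -- bin i j is the binomial coefficient (i + j) choose i.
  bin : ℕ → ℕ → ℤ
  bin zero    _       = 1ℤ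
  bin (suc _) zero    = 1ℤ
  bin (suc i) (suc j) = bin i (suc j) + bin (suc i) j

  bin-zeroʳ : ∀ i → bin i 0 ≡ 1ℤ
  bin-zeroʳ zero    = refl
  bin-zeroʳ (suc _) = refl

  bin-sym : ∀ i j → bin i j ≡ bin j i
  bin-sym zero    j       = sym (bin-zeroʳ j)
  bin-sym (suc _) zero    = refl
  bin-sym (suc i) (suc j) = begin
    bin i (suc j) + bin (suc i) j ≡⟨ cong₂ _+_ (bin-sym i (suc j)) (bin-sym (suc i) j) ⟩
    bin (suc j) i + bin j (suc i) ≡⟨ ℤ.+-comm (bin (suc j) i) (bin j (suc i)) ⟩
    bin j (suc i) + bin (suc j) i ∎

  -- Both sides are (i + j + 1)! / (i! j!). This is the ratio of neighbouring binomials on an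
  -- antidiagonal, cleared of denominators and proved from Pascal's rule alone.
  bin-shift : ∀ i j → + suc i * bin (suc i) j ≡ + suc j * bin i (suc j)
  bin-shift zero    zero    = refl
  bin-shift zero    (suc j) = begin
    1ℤ * (1ℤ + bin 1 j)        ≡⟨ expand (bin 1 j) ⟩
    1ℤ + 1ℤ * bin 1 j          ≡⟨ cong (λ x → 1ℤ + x) (bin-shift zero j) ⟩
    1ℤ + + suc j * 1ℤ          ≡⟨ collect (+ suc j) ⟩
    + suc (suc j) * 1ℤ         ∎
    where
    expand : ∀ x → 1ℤ * (1ℤ + x) ≡ 1ℤ + 1ℤ * x
    expand = solve-∀
    collect : ∀ y → 1ℤ + y * 1ℤ ≡ (1ℤ + y) * 1ℤ
    collect = solve-∀
  bin-shift (suc i) zero    = begin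
    + suc (suc i) * 1ℤ         ≡⟨ expand (+ suc i) ⟩
    + suc i * 1ℤ + 1ℤ          ≡⟨ cong (λ x → x + 1ℤ) (bin-shift i zero) ⟩
    1ℤ * bin i 1 + 1ℤ          ≡⟨ collect (bin i 1) ⟩
    1ℤ * (bin i 1 + 1ℤ)        ∎
    where
    expand : ∀ x → (1ℤ + x) * 1ℤ ≡ x * 1ℤ + 1ℤ
    expand = solve-∀
    collect : ∀ y → 1ℤ * y + 1ℤ ≡ 1ℤ * (y + 1ℤ)
    collect = solve-∀
  bin-shift (suc i) (suc j) = begin
    (1ℤ + x) * (B + E)           ≡⟨ expand x B E ⟩
    x * B + (1ℤ + x) * E + B     ≡⟨ cong₂ (λ u v → u + v + B) (bin-shift i (suc j)) (bin-shift (suc i) j) ⟩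
    (1ℤ + y) * F + y * B + B     ≡⟨ collect y B F ⟩
    (1ℤ + y) * (F + B)           ∎
    where
    x = + suc i
    y = + suc j
    B = bin (suc i) (suc j)
    E = bin (suc (suc i)) j
    F = bin i (suc (suc j))
    expand : ∀ x B E → (1ℤ + x) * (B + E) ≡ x * B + (1ℤ + x) * E + B
    expand = solve-∀
    collect : ∀ y B F → (1ℤ + y) * F + y * B + B ≡ (1ℤ + y) * (F + B)
    collect = solve-∀

  -- The sum of (a + b choose k) over b < k ≤ a if b ≤ a, extended
  -- antisymmetrically to b > a.
  T : ℕ → ℕ → ℤ
  T zero    zero    = 0ℤ
  T (suc a) zero    = + 2 * T a zero + 1ℤ
  T a       (suc b) = + 2 * T a b - bin a (suc b)

  T-sucʳ : ∀ a b → T a (suc b) ≡ + 2 * T a b - bin a (suc b)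
  T-sucʳ zero    b = refl
  T-sucʳ (suc a) b = refl

  -- The clauses of `T` recurse on b, so the rule in a is definitional only at b = 0. For b + 1 the
  -- two doubling rules commute, because their corrections add up by Pascal's rule.
  T-sucˡ : ∀ a b → T (suc a) b ≡ + 2 * T a b + bin (suc a) b
  T-sucˡ a zero    = refl
  T-sucˡ a (suc b) = begin
    + 2 * T (suc a) b - bin (suc a) (suc b)
      ≡⟨ cong (λ x → + 2 * x - bin (suc a) (suc b)) (T-sucˡ a b) ⟩
    + 2 * (+ 2 * T a b + bin (suc a) b) - bin (suc a) (suc b)
      ≡⟨ rearrange (T a b) (bin a (suc b)) (bin (suc a) b) ⟩
    + 2 * (+ 2 * T a b - bin a (suc b)) + bin (suc a) (suc b)
      ≡⟨ cong (λ x → + 2 * x + bin (suc a) (suc b)) (T-sucʳ a b) ⟨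
    + 2 * T a (suc b) + bin (suc a) (suc b) ∎
    where
    rearrange : ∀ t u v → + 2 * (+ 2 * t + v) - (u + v) ≡ + 2 * (+ 2 * t - u) + (u + v)
    rearrange = solve-∀

  -- This is the first-step recursion of `walks` in other coordinates, and the reason why `T` counts
  -- walks.
  T-pascal : ∀ a b → T (suc a) (suc b) ≡ T a (suc b) + T (suc a) b
  T-pascal a b = begin
    + 2 * T (suc a) b - (bin a (suc b) + bin (suc a) b)
      ≡⟨ split (T (suc a) b) (bin a (suc b)) (bin (suc a) b) ⟩
    T (suc a) b - bin (suc a) b - bin a (suc b) + T (suc a) b
      ≡⟨ cong (λ x → x - bin (suc a) b - bin a (suc b) + T (suc a) b) (T-sucˡ a b) ⟩
    + 2 * T a b + bin (suc a) b - bin (suc a) b - bin a (suc b) + T (suc a) b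
      ≡⟨ cancel (T a b) (bin (suc a) b) (bin a (suc b)) (T (suc a) b) ⟩
    + 2 * T a b - bin a (suc b) + T (suc a) b
      ≡⟨ cong (λ x → x + T (suc a) b) (T-sucʳ a b) ⟨
    T a (suc b) + T (suc a) b ∎
    where
    split : ∀ t u v → + 2 * t - (u + v) ≡ t - v - u + t
    split = solve-∀
    cancel : ∀ t u v w → + 2 * t + u - u - v + w ≡ + 2 * t - v + w
    cancel = solve-∀

  -- The empty sum; in the reflection argument it is the value zero at the absorbing boundary.
  T-diag : ∀ a → T a a ≡ 0ℤ
  T-diag zero    = refl
  T-diag (suc a) = begin
    + 2 * T (suc a) a - (bin a (suc a) + bin (suc a) a)
      ≡⟨ cong₂ (λ t u → + 2 * t - (u + bin (suc a) a)) (T-sucˡ a a) (bin-sym a (suc a)) ⟩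
    + 2 * (+ 2 * T a a + bin (suc a) a) - (bin (suc a) a + bin (suc a) a)
      ≡⟨ cong (λ t → + 2 * (+ 2 * t + bin (suc a) a) - (bin (suc a) a + bin (suc a) a)) (T-diag a) ⟩
    + 2 * (+ 2 * 0ℤ + bin (suc a) a) - (bin (suc a) a + bin (suc a) a)
      ≡⟨ cancel (bin (suc a) a) ⟩
    0ℤ ∎
    where
    cancel : ∀ u → + 2 * (+ 2 * 0ℤ + u) - (u + u) ≡ 0ℤ
    cancel = solve-∀

  -- Sums over b and Catalan multiples as boundary values

  Σ≤ : ℕ → (ℕ → ℤ) → ℤ
  Σ≤ zero    g = g 0
  Σ≤ (suc k) g = Σ≤ k g + g (suc k)

  -- The Catalan number with index a + 1.
  cat : ℕ → ℤ
  cat a = bin (suc a) (suc a) - bin a (suc (suc a))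

  -- Squaring `T-sucˡ` leads from the sum of T² to `P`, `Q` and `R`. The term b = a of `P` vanishes
  -- by `T-diag`, so the three sums can share one range.
  P Q R S Y : ℕ → ℤ
  P a = Σ≤ a λ b → T a b * T a b
  Q a = Σ≤ a λ b → T a b * bin (suc a) b
  R a = Σ≤ a λ b → bin (suc a) b * bin (suc a) b
  S zero    = 0ℤ
  S (suc m) = S m + P m
  Y a = cat a * cat a

  bin-suc-diag : ∀ a → bin (suc a) (suc a) ≡ + 2 * bin (suc a) a
  bin-suc-diag a = begin
    bin a (suc a) + bin (suc a) a  ≡⟨ cong (λ x → x + bin (suc a) a) (bin-sym a (suc a)) ⟩
    bin (suc a) a + bin (suc a) a  ≡⟨ double (bin (suc a) a) ⟩
    + 2 * bin (suc a) a            ∎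
    where
    double : ∀ x → x + x ≡ + 2 * x
    double = solve-∀

  -- This and the next two lemmas write the binomials left over by telescoping, (2a + 2 choose a +
  -- 1), (2a + 2 choose a) and (2a + 3 choose a + 1), as integer multiples of one Catalan number.
  -- The inhomogeneous terms thereby become polynomials times `Y`.
  cat-central : ∀ a → bin (suc a) (suc a) ≡ + (2 ℕ.+ a) * cat a
  cat-central a = begin
    u                                        ≡⟨ expand (+ suc a) u ⟩
    (1ℤ + + suc a) * u - + suc a * u         ≡⟨ cong (λ x → (1ℤ + + suc a) * u - x) (bin-shift (suc a) a) ⟨
    (1ℤ + + suc a) * u - (1ℤ + + suc a) * bin (2 ℕ.+ a) a
      ≡⟨ cong (λ x → (1ℤ + + suc a) * u - (1ℤ + + suc a) * x) (bin-sym (suc (suc a)) a) ⟩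
    (1ℤ + + suc a) * u - (1ℤ + + suc a) * v  ≡⟨ collect (1ℤ + + suc a) u v ⟩
    (1ℤ + + suc a) * (u - v)                 ∎
    where
    u = bin (suc a) (suc a)
    v = bin a (suc (suc a))
    expand : ∀ x u → u ≡ (1ℤ + x) * u - x * u
    expand = solve-∀
    collect : ∀ x u v → x * u - x * v ≡ x * (u - v)
    collect = solve-∀

  cat-below : ∀ a → bin (2 ℕ.+ a) a ≡ + suc a * cat a
  cat-below a = begin
    bin (2 ℕ.+ a) a                    ≡⟨ bin-sym (2 ℕ.+ a) a ⟩
    v                                  ≡⟨ expand (bin (suc a) (suc a)) v ⟩
    bin (suc a) (suc a) - cat a        ≡⟨ cong (λ x → x - cat a) (cat-central a) ⟩
    (1ℤ + + suc a) * cat a - cat a     ≡⟨ collect (+ suc a) (cat a) ⟩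
    + suc a * cat a                    ∎
    where
    v = bin a (suc (suc a))
    expand : ∀ u v → v ≡ u - (u - v)
    expand = solve-∀
    collect : ∀ x c → (1ℤ + x) * c - c ≡ x * c
    collect = solve-∀

  cat-next : ∀ a → bin (2 ℕ.+ a) (suc a) ≡ (+ 2 * + suc a + 1ℤ) * cat a
  cat-next a = begin
    bin (suc a) (suc a) + bin (2 ℕ.+ a) a       ≡⟨ cong₂ _+_ (cat-central a) (cat-below a) ⟩
    (+ 2 + + a) * cat a + (1ℤ + + a) * cat a    ≡⟨ collect (+ a) (cat a) ⟩
    (+ 2 * + suc a + 1ℤ) * cat a                ∎
    where
    collect : ∀ x c → (+ 2 + x) * c + (1ℤ + x) * c ≡ (+ 2 * (1ℤ + x) + 1ℤ) * c
    collect = solve-∀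

  cat-rec : ∀ a → (+ suc a + + 2) * cat (suc a) ≡ + 2 * (+ 2 * + suc a + 1ℤ) * cat a
  cat-rec a = begin
    (+ suc a + + 2) * cat (suc a)          ≡⟨ cong (λ x → x * cat (suc a)) (ℤ.+-comm (+ suc a) (+ 2)) ⟩
    + (3 ℕ.+ a) * cat (suc a)              ≡⟨ cat-central (suc a) ⟨
    bin (2 ℕ.+ a) (2 ℕ.+ a)                ≡⟨ bin-suc-diag (suc a) ⟩
    + 2 * bin (2 ℕ.+ a) (suc a)            ≡⟨ cong (λ x → + 2 * x) (cat-next a) ⟩
    + 2 * ((+ 2 * + suc a + 1ℤ) * cat a)   ≡⟨ ℤ.*-assoc (+ 2) (+ 2 * + suc a + 1ℤ) (cat a) ⟨
    + 2 * (+ 2 * + suc a + 1ℤ) * cat a     ∎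

  -- The recurrences of Q, R and Y = cat² between the arguments n − 1 and n.
  QRelation : (n q q′ r y : ℤ) → Set
  QRelation n q q′ r y = + 4 * q + + 2 * q′ + + 3 * r ≡ (+ 3 * n + + 2) * n * y

  RRelation : (n r r′ y : ℤ) → Set
  RRelation n r r′ y = (n + 1ℤ) * r - + 2 * (+ 2 * n + + 3) * r′ ≡
                       - ((n + 1ℤ) * (+ 21 * (n * n) + + 22 * n + + 6) * y)

  YRelation : (n y y′ : ℤ) → Set
  YRelation n y y′ = (n + + 2) * (n + + 2) * y′ ≡ + 4 * (+ 2 * n + 1ℤ) * (+ 2 * n + 1ℤ) * y

  Y-rec : ∀ a → YRelation (+ suc a) (Y a) (Y (suc a))
  Y-rec a = begin
    (n + + 2) * (n + + 2) * Y (suc a)                               ≡⟨ regroup (n + + 2) (cat (suc a)) ⟩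
    ((n + + 2) * cat (suc a)) * ((n + + 2) * cat (suc a))           ≡⟨ cong (λ x → x * x) (cat-rec a) ⟩
    (+ 2 * (+ 2 * n + 1ℤ) * cat a) * (+ 2 * (+ 2 * n + 1ℤ) * cat a) ≡⟨ regroup′ (+ 2 * n + 1ℤ) (cat a) ⟩
    + 4 * (+ 2 * n + 1ℤ) * (+ 2 * n + 1ℤ) * Y a                     ∎
    where
    n = + suc a
    regroup : ∀ x c → x * x * (c * c) ≡ (x * c) * (x * c)
    regroup = solve-∀
    regroup′ : ∀ x c → (+ 2 * x * c) * (+ 2 * x * c) ≡ + 4 * x * x * (c * c)
    regroup′ = solve-∀

  -- First-order recurrences by telescoping

  P-partial : ∀ a k → Σ≤ k (λ b → T (suc a) b * T (suc a) b) ≡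
    + 4 * Σ≤ k (λ b → T a b * T a b) + + 4 * Σ≤ k (λ b → T a b * bin (suc a) b)
      + Σ≤ k (λ b → bin (suc a) b * bin (suc a) b)
  P-partial a zero    = square (T a 0)
    where
    square : ∀ t → (+ 2 * t + 1ℤ) * (+ 2 * t + 1ℤ) ≡ + 4 * (t * t) + + 4 * (t * 1ℤ) + 1ℤ * 1ℤ
    square = solve-∀
  P-partial a (suc k) = begin
    Σ≤ k (λ b → T (suc a) b * T (suc a) b) + T (suc a) (suc k) * T (suc a) (suc k)
      ≡⟨ cong₂ (λ s t → s + t * t) (P-partial a k) (T-sucˡ a (suc k)) ⟩
    + 4 * p + + 4 * q + r + (+ 2 * t + u) * (+ 2 * t + u)
      ≡⟨ square p q r t u ⟩
    + 4 * (p + t * t) + + 4 * (q + t * u) + (r + u * u) ∎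
    where
    p = Σ≤ k λ b → T a b * T a b
    q = Σ≤ k λ b → T a b * bin (suc a) b
    r = Σ≤ k λ b → bin (suc a) b * bin (suc a) b
    t = T a (suc k)
    u = bin (suc a) (suc k)
    square : ∀ p q r t u → + 4 * p + + 4 * q + r + (+ 2 * t + u) * (+ 2 * t + u) ≡
             + 4 * (p + t * t) + + 4 * (q + t * u) + (r + u * u)
    square = solve-∀

  P-rec : ∀ a → P (suc a) ≡ + 4 * P a + + 4 * Q a + R a
  P-rec a = begin
    Σ≤ a (λ b → T (suc a) b * T (suc a) b) + T (suc a) (suc a) * T (suc a) (suc a)
      ≡⟨ cong₂ (λ s t → s + t * t) (P-partial a a) (T-diag (suc a)) ⟩
    + 4 * P a + + 4 * Q a + R a + 0ℤ
      ≡⟨ ℤ.+-identityʳ _ ⟩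
    + 4 * P a + + 4 * Q a + R a ∎

  -- Creative telescoping: the right-hand side at k is the antidifference of the summands. The
  -- coefficients 4 and 2 make the terms containing `T` telescope to a multiple of `T a (suc k)`,
  -- and 3 accounts for the products of binomials that remain.
  Q-partial : ∀ a k →
    + 4 * Σ≤ k (λ b → T a b * bin (suc a) b)
      + + 2 * Σ≤ k (λ b → T (suc a) b * bin (2 ℕ.+ a) b)
      + + 3 * Σ≤ k (λ b → bin (suc a) b * bin (suc a) b)
    ≡ bin (2 ℕ.+ a) k * (bin (2 ℕ.+ a) k + + 4 * bin (suc a) (suc k) + + 4 * T a (suc k))
  Q-partial a zero    = begin
    + 4 * (T a 0 * 1ℤ) + + 2 * ((+ 2 * T a 0 + 1ℤ) * 1ℤ) + + 3 * (1ℤ * 1ℤ)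
      ≡⟨ base (T a 0) (bin a 1) ⟩
    1ℤ * (1ℤ + + 4 * (bin a 1 + 1ℤ) + + 4 * (+ 2 * T a 0 - bin a 1))
      ≡⟨ cong (λ t → 1ℤ * (1ℤ + + 4 * (bin a 1 + 1ℤ) + + 4 * t)) (T-sucʳ a 0) ⟨
    1ℤ * (1ℤ + + 4 * (bin a 1 + 1ℤ) + + 4 * T a 1) ∎
    where
    base : ∀ t u → + 4 * (t * 1ℤ) + + 2 * ((+ 2 * t + 1ℤ) * 1ℤ) + + 3 * (1ℤ * 1ℤ) ≡
           1ℤ * (1ℤ + + 4 * (u + 1ℤ) + + 4 * (+ 2 * t - u))
    base = solve-∀
  Q-partial a (suc k) = begin
    + 4 * (q + t * B) + + 2 * (q′ + T (suc a) (suc k) * (B + N)) + + 3 * (r + B * B)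
      ≡⟨ cong (λ x → + 4 * (q + t * B) + + 2 * (q′ + x * (B + N)) + + 3 * (r + B * B)) (T-sucˡ a (suc k)) ⟩
    + 4 * (q + t * B) + + 2 * (q′ + (+ 2 * t + B) * (B + N)) + + 3 * (r + B * B)
      ≡⟨ separate q q′ r t B N ⟩
    + 4 * q + + 2 * q′ + + 3 * r + (+ 4 * (t * B) + + 2 * ((+ 2 * t + B) * (B + N)) + + 3 * (B * B))
      ≡⟨ cong (λ x → x + (+ 4 * (t * B) + + 2 * ((+ 2 * t + B) * (B + N)) + + 3 * (B * B))) (Q-partial a k) ⟩
    N * (N + + 4 * B + + 4 * t) + (+ 4 * (t * B) + + 2 * ((+ 2 * t + B) * (B + N)) + + 3 * (B * B))
      ≡⟨ telescope t B N M ⟩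
    (B + N) * (B + N + + 4 * (M + B) + + 4 * (+ 2 * t - M))
      ≡⟨ cong (λ x → (B + N) * (B + N + + 4 * (M + B) + + 4 * x)) (T-sucʳ a (suc k)) ⟨
    (B + N) * (B + N + + 4 * (M + B) + + 4 * T a (suc (suc k))) ∎
    where
    q  = Σ≤ k λ b → T a b * bin (suc a) b
    q′ = Σ≤ k λ b → T (suc a) b * bin (2 ℕ.+ a) b
    r  = Σ≤ k λ b → bin (suc a) b * bin (suc a) b
    t  = T a (suc k)
    B  = bin (suc a) (suc k)
    N  = bin (2 ℕ.+ a) k
    M  = bin a (suc (suc k))
    separate : ∀ q q′ r t B N →
      + 4 * (q + t * B) + + 2 * (q′ + (+ 2 * t + B) * (B + N)) + + 3 * (r + B * B) ≡
      + 4 * q + + 2 * q′ + + 3 * r + (+ 4 * (t * B) + + 2 * ((+ 2 * t + B) * (B + N)) + + 3 * (B * B))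
    separate = solve-∀
    telescope : ∀ t B N M →
      N * (N + + 4 * B + + 4 * t) + (+ 4 * (t * B) + + 2 * ((+ 2 * t + B) * (B + N)) + + 3 * (B * B)) ≡
      (B + N) * (B + N + + 4 * (M + B) + + 4 * (+ 2 * t - M))
    telescope = solve-∀

  Q-rec : ∀ a → QRelation (+ suc a) (Q a) (Q (suc a)) (R a) (Y a)
  Q-rec a = begin
    + 4 * Q a + + 2 * (q′ + T (suc a) (suc a) * bin (2 ℕ.+ a) (suc a)) + + 3 * R a
      ≡⟨ cong (λ x → + 4 * Q a + + 2 * (q′ + x * bin (2 ℕ.+ a) (suc a)) + + 3 * R a) (T-diag (suc a)) ⟩
    + 4 * Q a + + 2 * (q′ + 0ℤ) + + 3 * R a
      ≡⟨ cong (λ x → + 4 * Q a + + 2 * x + + 3 * R a) (ℤ.+-identityʳ q′) ⟩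
    + 4 * Q a + + 2 * q′ + + 3 * R a
      ≡⟨ Q-partial a a ⟩
    N * (N + + 4 * bin (suc a) (suc a) + + 4 * T a (suc a))
      ≡⟨ cong (λ x → N * (N + + 4 * bin (suc a) (suc a) + + 4 * x)) boundary ⟩
    N * (N + + 4 * bin (suc a) (suc a) + + 4 * (- B))
      ≡⟨ cong (λ x → N * (N + + 4 * x + + 4 * (- B))) (bin-suc-diag a) ⟩
    N * (N + + 4 * (+ 2 * B) + + 4 * (- B))
      ≡⟨ halve N B ⟩
    N * (N + + 2 * (+ 2 * B))
      ≡⟨ cong (λ x → N * (N + + 2 * x)) (bin-suc-diag a) ⟨
    N * (N + + 2 * bin (suc a) (suc a))
      ≡⟨ cong₂ (λ x y → x * (x + + 2 * y)) (cat-below a) (cat-central a) ⟩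
    (1ℤ + + a) * cat a * ((1ℤ + + a) * cat a + + 2 * ((+ 2 + + a) * cat a))
      ≡⟨ collect (+ a) (cat a) ⟩
    (+ 3 * + suc a + + 2) * + suc a * Y a ∎
    where
    q′ = Σ≤ a λ b → T (suc a) b * bin (2 ℕ.+ a) b
    N  = bin (2 ℕ.+ a) a
    B  = bin (suc a) a
    -- The telescoped sum ends at k = a and evaluates `T` one place beyond the diagonal, where the
    -- antisymmetric extension is minus a single binomial.
    boundary : T a (suc a) ≡ - B
    boundary = begin
      T a (suc a)                 ≡⟨ T-sucʳ a a ⟩
      + 2 * T a a - bin a (suc a) ≡⟨ cong₂ (λ x y → + 2 * x - y) (T-diag a) (bin-sym a (suc a)) ⟩
      0ℤ - B                      ≡⟨ ℤ.+-identityˡ (- B) ⟩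
      - B                         ∎
    halve : ∀ N B → N * (N + + 4 * (+ 2 * B) + + 4 * (- B)) ≡ N * (N + + 2 * (+ 2 * B))
    halve = solve-∀
    collect : ∀ x c → (1ℤ + x) * c * ((1ℤ + x) * c + + 2 * ((+ 2 + x) * c)) ≡
                      (+ 3 * (1ℤ + x) + + 2) * (1ℤ + x) * (c * c)
    collect = solve-∀

  -- Creative telescoping again; the factor 2k + 3a + 8 is the certificate. Here the difference
  -- equation holds only modulo the relation `bin-shift`, not as a formal identity in the binomials.
  R-partial : ∀ a k →
    (+ a + + 2) * Σ≤ k (λ b → bin (suc a) b * bin (suc a) b)
      - + 2 * (+ 2 * + a + + 5) * Σ≤ k (λ b → bin (2 ℕ.+ a) b * bin (2 ℕ.+ a) b)
    ≡ - ((+ 2 * + k + + 3 * + a + + 8) * (bin (2 ℕ.+ a) k * bin (2 ℕ.+ a) k))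
  R-partial a zero    = base (+ a)
    where
    base : ∀ x → (x + + 2) * 1ℤ - + 2 * (+ 2 * x + + 5) * 1ℤ ≡ - ((0ℤ + + 3 * x + + 8) * 1ℤ)
    base = solve-∀
  R-partial a (suc k) = begin
    (x + + 2) * (r + B * B) - + 2 * (+ 2 * x + + 5) * (r′ + (B + N) * (B + N))
      ≡⟨ separate x r r′ B N ⟩
    (x + + 2) * r - + 2 * (+ 2 * x + + 5) * r′
      + ((x + + 2) * (B * B) - + 2 * (+ 2 * x + + 5) * ((B + N) * (B + N)))
      ≡⟨ cong (λ z → z + ((x + + 2) * (B * B) - + 2 * (+ 2 * x + + 5) * ((B + N) * (B + N)))) (R-partial a k) ⟩
    - ((+ 2 * + k + + 3 * x + + 8) * (N * N))
      + ((x + + 2) * (B * B) - + 2 * (+ 2 * x + + 5) * ((B + N) * (B + N)))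
      -- The error term is a multiple of (k + 1) B - (a + 2) N, which `bin-shift` makes zero.
      ≡⟨ telescope x (+ k) B N ⟩
    - ((+ 2 * (1ℤ + + k) + + 3 * x + + 8) * ((B + N) * (B + N)))
      + ((1ℤ + + k) * B - (+ 2 + x) * N) * (+ 2 * B + + 4 * N)
      ≡⟨ cong (λ z → - ((+ 2 * (1ℤ + + k) + + 3 * x + + 8) * ((B + N) * (B + N)))
                + ((1ℤ + + k) * B - z) * (+ 2 * B + + 4 * N)) (bin-shift (suc a) k) ⟩
    - ((+ 2 * (1ℤ + + k) + + 3 * x + + 8) * ((B + N) * (B + N)))
      + ((1ℤ + + k) * B - (1ℤ + + k) * B) * (+ 2 * B + + 4 * N)
      ≡⟨ cancel (- ((+ 2 * (1ℤ + + k) + + 3 * x + + 8) * ((B + N) * (B + N)))) ((1ℤ + + k) * B) (+ 2 * B + + 4 * N) ⟩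
    - ((+ 2 * (1ℤ + + k) + + 3 * x + + 8) * ((B + N) * (B + N))) ∎
    where
    x  = + a
    r  = Σ≤ k λ b → bin (suc a) b * bin (suc a) b
    r′ = Σ≤ k λ b → bin (2 ℕ.+ a) b * bin (2 ℕ.+ a) b
    B  = bin (suc a) (suc k)
    N  = bin (2 ℕ.+ a) k
    separate : ∀ x r r′ B N →
      (x + + 2) * (r + B * B) - + 2 * (+ 2 * x + + 5) * (r′ + (B + N) * (B + N)) ≡
      (x + + 2) * r - + 2 * (+ 2 * x + + 5) * r′
        + ((x + + 2) * (B * B) - + 2 * (+ 2 * x + + 5) * ((B + N) * (B + N)))
    separate = solve-∀
    telescope : ∀ x k B N →
      - ((+ 2 * k + + 3 * x + + 8) * (N * N))
        + ((x + + 2) * (B * B) - + 2 * (+ 2 * x + + 5) * ((B + N) * (B + N))) ≡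
      - ((+ 2 * (1ℤ + k) + + 3 * x + + 8) * ((B + N) * (B + N)))
        + ((1ℤ + k) * B - (+ 2 + x) * N) * (+ 2 * B + + 4 * N)
    telescope = solve-∀
    cancel : ∀ u v w → u + (v - v) * w ≡ u
    cancel = solve-∀

  R-rec : ∀ a → RRelation (+ suc a) (R a) (R (suc a)) (Y a)
  R-rec a = begin
    (1ℤ + x + 1ℤ) * R a - + 2 * (+ 2 * (1ℤ + x) + + 3) * (r′ + L * L)
      ≡⟨ separate x (R a) r′ L ⟩
    (x + + 2) * R a - + 2 * (+ 2 * x + + 5) * r′ - + 2 * (+ 2 * x + + 5) * (L * L)
      ≡⟨ cong₂ (λ u v → u - + 2 * (+ 2 * x + + 5) * (v * v)) (R-partial a a) (cat-next a) ⟩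
    - ((+ 2 * x + + 3 * x + + 8) * (N * N)) - + 2 * (+ 2 * x + + 5) * (M * M)
      ≡⟨ cong (λ u → - ((+ 2 * x + + 3 * x + + 8) * (u * u)) - + 2 * (+ 2 * x + + 5) * (M * M)) (cat-below a) ⟩
    - ((+ 2 * x + + 3 * x + + 8) * ((1ℤ + x) * c * ((1ℤ + x) * c))) - + 2 * (+ 2 * x + + 5) * (M * M)
      ≡⟨ collect x c ⟩
    - ((1ℤ + x + 1ℤ) * (+ 21 * ((1ℤ + x) * (1ℤ + x)) + + 22 * (1ℤ + x) + + 6) * (c * c)) ∎
    where
    x  = + a
    c  = cat a
    r′ = Σ≤ a λ b → bin (2 ℕ.+ a) b * bin (2 ℕ.+ a) b
    L  = bin (2 ℕ.+ a) (suc a)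
    M  = (+ 2 * (1ℤ + x) + 1ℤ) * c
    N  = bin (2 ℕ.+ a) a
    separate : ∀ x r r′ L →
      (1ℤ + x + 1ℤ) * r - + 2 * (+ 2 * (1ℤ + x) + + 3) * (r′ + L * L) ≡
      (x + + 2) * r - + 2 * (+ 2 * x + + 5) * r′ - + 2 * (+ 2 * x + + 5) * (L * L)
    separate = solve-∀
    collect : ∀ x c →
      - ((+ 2 * x + + 3 * x + + 8) * ((1ℤ + x) * c * ((1ℤ + x) * c)))
        - + 2 * (+ 2 * x + + 5) * ((+ 2 * (1ℤ + x) + 1ℤ) * c * ((+ 2 * (1ℤ + x) + 1ℤ) * c)) ≡
      - ((1ℤ + x + 1ℤ) * (+ 21 * ((1ℤ + x) * (1ℤ + x)) + + 22 * (1ℤ + x) + + 6) * (c * c))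
    collect = solve-∀

  -- Columns of a triangle and their enumeration

  -- The infinite words 2^ω, 1^(e+1) 2^ω and 0^(x+1) 1^(D+1) 2^ω. Such a word lists d down a
  -- column of the lower triangle, starting on the diagonal.
  data Word : Set where
    w₂ : Word
    w₁ : ℕ → Word
    w₀ : ℕ → ℕ → Word

  -- The words that can stand one column to the left of a given one, according to whether
  -- the diagonal letter stays the same or is one lower.
  same up succs : Word → List Word
  same w₂             = w₂ ∷ []
  same (w₁ e)         = w₁ e ∷ w₁ (suc e) ∷ []
  same (w₀ x zero)    = w₀ x zero ∷ w₀ (suc x) zero ∷ w₀ x 1 ∷ []
  same (w₀ x (suc D)) = w₀ x (suc D) ∷ w₀ (suc x) (suc D) ∷ w₀ x (suc (suc D)) ∷ w₀ (suc x) D ∷ []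
  up w₂               = w₁ 0 ∷ []
  up (w₁ zero)        = w₀ 0 zero ∷ []
  up (w₁ (suc e))     = w₀ 0 e ∷ w₀ 0 (suc e) ∷ []
  up (w₀ _ _)         = []
  succs h = same h ++ up h

  head : Word → ℕ
  head w₂       = 2
  head (w₁ _)   = 1
  head (w₀ _ _) = 0

  same-head : ∀ h → All (λ k → head k ≡ head h) (same h)
  same-head w₂             = refl ∷ []
  same-head (w₁ _)         = refl ∷ refl ∷ []
  same-head (w₀ _ zero)    = refl ∷ refl ∷ refl ∷ []
  same-head (w₀ _ (suc _)) = refl ∷ refl ∷ refl ∷ refl ∷ []

  up-head : ∀ h → All (λ k → suc (head k) ≡ head h) (up h)
  up-head w₂           = refl ∷ []
  up-head (w₁ zero)    = refl ∷ []
  up-head (w₁ (suc _)) = refl ∷ refl ∷ []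
  up-head (w₀ _ _)     = []

  -- The first column of the lower triangle and the first row of the upper one.
  State : Set
  State = Word × Word

  successors : State → List State
  successors (h , k) = cartesianProduct (same h) (same k) ++ cartesianProduct (up h) (up k)

  -- The number of ways to add m columns and rows to the left and on top so that the
  -- corner becomes 0.
  extensions : ℕ → State → ℕ
  extensions zero    (w₀ _ _ , _) = 1
  extensions zero    (_ , _)     = 0
  extensions (suc m) s           = sum (map (extensions m) (successors s))

  -- The number of walks of L steps ±1 from x that stay positive.
  walks : ℕ → ℕ → ℕ
  walks _       zero    = 0
  walks zero    (suc x) = 1
  walks (suc L) (suc x) = walks L x ℕ.+ walks L (suc (suc x))

  -- A walk that starts above its number of steps cannot reach 0, so all 2^L walks count; `T L 0` is
  -- 2^L - 1, as it omits (L choose 0).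
  walks-free : ∀ L k → + walks L (L ℕ.+ suc k) ≡ T L 0 + 1ℤ
  walks-free zero    k = refl
  walks-free (suc L) k = begin
    + walks L (L ℕ.+ suc k) + + walks L (suc (suc (L ℕ.+ suc k)))
      ≡⟨ cong (λ x → + walks L (L ℕ.+ suc k) + + walks L x) shift ⟩
    + walks L (L ℕ.+ suc k) + + walks L (L ℕ.+ suc (suc (suc k)))
      ≡⟨ cong₂ _+_ (walks-free L k) (walks-free L (suc (suc k))) ⟩
    T L 0 + 1ℤ + (T L 0 + 1ℤ)
      ≡⟨ double (T L 0) ⟩
    + 2 * T L 0 + 1ℤ + 1ℤ ∎
    where
    shift : suc (suc (L ℕ.+ suc k)) ≡ L ℕ.+ suc (suc (suc k))
    shift = sym (trans (ℕ.+-suc L _) (cong suc (ℕ.+-suc L _)))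
    double : ∀ t → t + 1ℤ + (t + 1ℤ) ≡ + 2 * t + 1ℤ + 1ℤ
    double = solve-∀

  -- The reflection principle as an induction on the first step: a downward step keeps i, an upward
  -- one lowers it, and `T-pascal` is the same recursion. At s = 0 both sides vanish. At i = 0 an
  -- upward step would need i = -1; it leads to s + 2 with s steps left, where the walk is free.
  walks-T : ∀ L i s → L ≡ i ℕ.+ i ℕ.+ s → + walks L s ≡ T (i ℕ.+ s) i
  walks-T L       i       zero    _    = sym (trans (cong (λ j → T j i) (ℕ.+-identityʳ i)) (T-diag i))
  walks-T zero    zero    (suc s) ()
  walks-T zero    (suc i) (suc s) ()
  walks-T (suc L) zero    (suc s) refl = begin
    + walks s s + + walks s (suc (suc s))
      ≡⟨ cong₂ _+_ (walks-T s 0 s refl) (cong (λ x → + walks s x) (ℕ.+-comm 2 s)) ⟩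
    T s 0 + + walks s (s ℕ.+ 2)
      ≡⟨ cong (λ x → T s 0 + x) (walks-free s 1) ⟩
    T s 0 + (T s 0 + 1ℤ)
      ≡⟨ double (T s 0) ⟩
    + 2 * T s 0 + 1ℤ ∎
    where
    double : ∀ t → t + (t + 1ℤ) ≡ + 2 * t + 1ℤ
    double = solve-∀
  walks-T (suc L) (suc i) (suc s) eq = begin
    + walks L s + + walks L (suc (suc s))
      ≡⟨ cong₂ _+_ (walks-T L (suc i) s eq₁) (walks-T L i (suc (suc s)) eq₂) ⟩
    T (suc i ℕ.+ s) (suc i) + T (i ℕ.+ suc (suc s)) i
      ≡⟨ cong₂ (λ x y → T x (suc i) + T y i) (sym (ℕ.+-suc i s)) (ℕ.+-suc i (suc s)) ⟩
    T (i ℕ.+ suc s) (suc i) + T (suc (i ℕ.+ suc s)) i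
      ≡⟨ T-pascal (i ℕ.+ suc s) i ⟨
    T (suc i ℕ.+ suc s) (suc i) ∎
    where
    eq₁ : L ≡ suc i ℕ.+ suc i ℕ.+ s
    eq₁ = trans (ℕ.suc-injective eq) (ℕ.+-suc (i ℕ.+ suc i) s)
    eq₂ : L ≡ i ℕ.+ i ℕ.+ suc (suc s)
    eq₂ = trans (ℕ.suc-injective eq)
         (trans (cong (λ x → x ℕ.+ suc s) (ℕ.+-suc i i)) (sym (ℕ.+-suc (i ℕ.+ i) (suc s))))

  -- Extensions as walks of the gap

  double : ℕ → ℕ
  double zero    = zero
  double (suc n) = suc (suc (double n))

  double-+ : ∀ n → double n ≡ n ℕ.+ n
  double-+ zero    = refl
  double-+ (suc n) = cong suc (trans (cong suc (double-+ n)) (sym (ℕ.+-suc n n)))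

  -- The gap D + 1 between the two thresholds of w₀ x D changes by −1, 0, 0 or 1 from one column
  -- to the next, that is, by two half steps of a simple walk.
  weight : ℕ → Word → ℕ
  weight m (w₀ _ D) = walks (double m) (double (suc D))
  weight m _       = 0

  -- The source of the squares: a pair of words moves within a Cartesian product, so a weight that
  -- factors keeps factoring. The predicate `Pr` restricts this to words with diagonal letter 0,
  -- where `extensions` does factor.
  product-sum : ∀ (Pr : Word → Set) (w : State → ℕ) (u v : Word → ℕ) →
    (∀ {h k} → Pr h → Pr k → w (h , k) ≡ u h ℕ.* v k) →
    ∀ {hs ks} → All Pr hs → All Pr ks →
    sum (map w (cartesianProduct hs ks)) ≡ sum (map u hs) ℕ.* sum (map v ks)
  product-sum Pr w u v w≡ []                     ps = refl
  product-sum Pr w u v w≡ {h ∷ hs} {ks} (p ∷ qs) ps = begin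
    sum (map w (map (h ,_) ks ++ cartesianProduct hs ks))
      ≡⟨ cong sum (map-++ w (map (h ,_) ks) _) ⟩
    sum (map w (map (h ,_) ks) ++ map w (cartesianProduct hs ks))
      ≡⟨ sum-++ (map w (map (h ,_) ks)) _ ⟩
    sum (map w (map (h ,_) ks)) ℕ.+ sum (map w (cartesianProduct hs ks))
      ≡⟨ cong₂ ℕ._+_ (row ps) (product-sum Pr w u v w≡ qs ps) ⟩
    u h ℕ.* sum (map v ks) ℕ.+ sum (map u hs) ℕ.* sum (map v ks)
      ≡⟨ ℕ.*-distribʳ-+ (sum (map v ks)) (u h) (sum (map u hs)) ⟨
    (u h ℕ.+ sum (map u hs)) ℕ.* sum (map v ks) ∎
    where
    row : ∀ {ks} → All Pr ks → sum (map w (map (h ,_) ks)) ≡ u h ℕ.* sum (map v ks)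
    row []              = sym (ℕ.*-zeroʳ (u h))
    row {k ∷ _} (r ∷ rs) = trans (cong₂ ℕ._+_ (w≡ p r) (row rs)) (sym (ℕ.*-distribˡ-+ (u h) (v k) _))

  successors-sum : ∀ (w : State → ℕ) h k → sum (map w (successors (h , k))) ≡
    sum (map w (cartesianProduct (same h) (same k))) ℕ.+ sum (map w (cartesianProduct (up h) (up k)))
  successors-sum w h k = trans
    (cong sum (map-++ w (cartesianProduct (same h) (same k)) _))
    (sum-++ (map w (cartesianProduct (same h) (same k))) _)

  -- The four successors are the four outcomes of two steps of the walk. At D = 0 the fourth outcome
  -- is the walk that hits 0, matching the missing successor.
  weight-same : ∀ m x D → sum (map (weight m) (same (w₀ x D))) ≡ weight (suc m) (w₀ x D)
  weight-same m x zero    = rearrange (walks (double m) 2) (walks (double m) 4)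
    where
    rearrange : ∀ p q → p ℕ.+ (p ℕ.+ (q ℕ.+ 0)) ≡ p ℕ.+ (p ℕ.+ q)
    rearrange = ℕ-Solver.solve-∀
  weight-same m x (suc D) =
    rearrange (w (suc D)) (w (suc (suc D))) (w (suc (suc (suc D))))
    where
    w : ℕ → ℕ
    w n = walks (double m) (double n)
    rearrange : ∀ p q r → q ℕ.+ (q ℕ.+ (r ℕ.+ (p ℕ.+ 0))) ≡ p ℕ.+ q ℕ.+ (q ℕ.+ r)
    rearrange = ℕ-Solver.solve-∀

  extensions-w₀ : ∀ m {h k} → head h ≡ 0 → head k ≡ 0 →
    extensions m (h , k) ≡ weight m h ℕ.* weight m k
  extensions-w₀ zero    {w₀ _ _} {w₀ _ _} refl refl = refl
  extensions-w₀ (suc m) {w₀ x D} {w₀ y E} refl refl = begin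
    sum (map (extensions m) (successors (w₀ x D , w₀ y E)))
      ≡⟨ successors-sum (extensions m) (w₀ x D) (w₀ y E) ⟩
    sum (map (extensions m) (cartesianProduct (same (w₀ x D)) (same (w₀ y E)))) ℕ.+ 0
      ≡⟨ ℕ.+-identityʳ _ ⟩
    sum (map (extensions m) (cartesianProduct (same (w₀ x D)) (same (w₀ y E))))
      ≡⟨ product-sum (λ h → head h ≡ 0) (extensions m) (weight m) (weight m) (extensions-w₀ m)
           (same-head (w₀ x D)) (same-head (w₀ y E)) ⟩
    sum (map (weight m) (same (w₀ x D))) ℕ.* sum (map (weight m) (same (w₀ y E)))
      ≡⟨ cong₂ ℕ._*_ (weight-same m x D) (weight-same m y E) ⟩
    weight (suc m) (w₀ x D) ℕ.* weight (suc m) (w₀ y E) ∎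

  -- The recursion raises s, like that of `crossings`; the term split off at s = 0 is the case in
  -- which the diagonal letter drops to 0 at once.
  antidiagonal : ℕ → (ℕ → ℕ → ℕ) → ℕ
  antidiagonal zero    g = g 0 0
  antidiagonal (suc m) g = antidiagonal m (λ s t → g (suc s) t) ℕ.+ g 0 (suc m)

  antidiagonal-cong : ∀ m {g h : ℕ → ℕ → ℕ} → (∀ s t → g s t ≡ h s t) →
                      antidiagonal m g ≡ antidiagonal m h
  antidiagonal-cong zero    g≗h = g≗h 0 0
  antidiagonal-cong (suc m) g≗h =
    cong₂ ℕ._+_ (antidiagonal-cong m λ s t → g≗h (suc s) t) (g≗h 0 (suc m))

  antidiagonal-+ : ∀ m (g h : ℕ → ℕ → ℕ) →
    antidiagonal m (λ s t → g s t ℕ.+ h s t) ≡ antidiagonal m g ℕ.+ antidiagonal m h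
  antidiagonal-+ zero    g h = refl
  antidiagonal-+ (suc m) g h = begin
    antidiagonal m (λ s t → g (suc s) t ℕ.+ h (suc s) t) ℕ.+ (g 0 (suc m) ℕ.+ h 0 (suc m))
      ≡⟨ cong (ℕ._+ (g 0 (suc m) ℕ.+ h 0 (suc m)))
           (antidiagonal-+ m (λ s t → g (suc s) t) (λ s t → h (suc s) t)) ⟩
    antidiagonal m (λ s t → g (suc s) t) ℕ.+ antidiagonal m (λ s t → h (suc s) t)
      ℕ.+ (g 0 (suc m) ℕ.+ h 0 (suc m))
      ≡⟨ interchange (antidiagonal m λ s t → g (suc s) t) (antidiagonal m λ s t → h (suc s) t)
           (g 0 (suc m)) (h 0 (suc m)) ⟩
    (antidiagonal m (λ s t → g (suc s) t) ℕ.+ g 0 (suc m))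
      ℕ.+ (antidiagonal m (λ s t → h (suc s) t) ℕ.+ h 0 (suc m)) ∎
    where
    interchange : ∀ p q r s → p ℕ.+ q ℕ.+ (r ℕ.+ s) ≡ p ℕ.+ r ℕ.+ (q ℕ.+ s)
    interchange = ℕ-Solver.solve-∀

  -- The number of ways to continue w₁ e by s further words w₁ and then by t + 1 words w₀.
  crossings : ℕ → ℕ → ℕ → ℕ
  crossings zero    t e = walks (suc (double t)) (suc (double e))
  crossings (suc s) t e = crossings s t e ℕ.+ crossings s t (suc e)

  -- With `w₁ e` at height 2e + 1, keeping or raising e is one step of the walk after a shift of the
  -- height by one. Each `w₁` and the first `w₀` cost one step, each later `w₀` two.
  crossings-walks : ∀ s t e → crossings s t e ≡ walks (suc (double t ℕ.+ s)) (suc (double e ℕ.+ s))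
  crossings-walks zero    t e =
    cong₂ (λ x y → walks (suc x) (suc y)) (sym (ℕ.+-identityʳ (double t))) (sym (ℕ.+-identityʳ (double e)))
  crossings-walks (suc s) t e = begin
    crossings s t e ℕ.+ crossings s t (suc e)
      ≡⟨ cong₂ ℕ._+_ (crossings-walks s t e) (crossings-walks s t (suc e)) ⟩
    walks (suc (suc (double t ℕ.+ s))) (suc (suc (double e ℕ.+ s)))
      ≡⟨ cong₂ (λ x y → walks (suc x) (suc y)) (sym (ℕ.+-suc (double t) s)) (sym (ℕ.+-suc (double e) s)) ⟩
    walks (suc (double t ℕ.+ suc s)) (suc (double e ℕ.+ suc s)) ∎

  weight-up : ∀ m e → sum (map (weight m) (up (w₁ e))) ≡ crossings 0 m e
  weight-up m zero    = ℕ.+-identityʳ _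
  weight-up m (suc e) = cong (walks (double m) (double (suc e)) ℕ.+_) (ℕ.+-identityʳ _)

  extensions-w₁-suc : ∀ m e e′ → extensions (suc m) (w₁ e , w₁ e′) ≡
    extensions m (w₁ e , w₁ e′) ℕ.+ extensions m (w₁ e , w₁ (suc e′))
      ℕ.+ (extensions m (w₁ (suc e) , w₁ e′) ℕ.+ extensions m (w₁ (suc e) , w₁ (suc e′)))
      ℕ.+ crossings 0 m e ℕ.* crossings 0 m e′
  extensions-w₁-suc m e e′ = begin
    sum (map (extensions m) (successors (w₁ e , w₁ e′)))
      ≡⟨ successors-sum (extensions m) (w₁ e) (w₁ e′) ⟩
    sum (map (extensions m) (cartesianProduct (same (w₁ e)) (same (w₁ e′))))
      ℕ.+ sum (map (extensions m) (cartesianProduct (up (w₁ e)) (up (w₁ e′))))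
      ≡⟨ cong₂ ℕ._+_ (regroup (X (w₁ e) (w₁ e′)) (X (w₁ e) (w₁ (suc e′)))
                   (X (w₁ (suc e)) (w₁ e′)) (X (w₁ (suc e)) (w₁ (suc e′))))
           (product-sum (λ h → head h ≡ 0) (extensions m) (weight m) (weight m) (extensions-w₀ m)
             (rises e) (rises e′)) ⟩
    stay ℕ.+ sum (map (weight m) (up (w₁ e))) ℕ.* sum (map (weight m) (up (w₁ e′)))
      ≡⟨ cong₂ (λ x y → stay ℕ.+ x ℕ.* y) (weight-up m e) (weight-up m e′) ⟩
    stay ℕ.+ crossings 0 m e ℕ.* crossings 0 m e′ ∎
    where
    X : Word → Word → ℕ
    X h k = extensions m (h , k)
    stay : ℕ
    stay = X (w₁ e) (w₁ e′) ℕ.+ X (w₁ e) (w₁ (suc e′))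
           ℕ.+ (X (w₁ (suc e)) (w₁ e′) ℕ.+ X (w₁ (suc e)) (w₁ (suc e′)))
    regroup : ∀ p q r s → p ℕ.+ (q ℕ.+ (r ℕ.+ (s ℕ.+ 0))) ≡ p ℕ.+ q ℕ.+ (r ℕ.+ s)
    regroup = ℕ-Solver.solve-∀
    rises : ∀ e → All (λ h → head h ≡ 0) (up (w₁ e))
    rises e = All.map ℕ.suc-injective (up-head (w₁ e))

  -- Here e and e′ must be arbitrary, since a column that keeps the letter 1 raises them
  -- independently. The four resulting terms factor into a product of two values of
  -- `crossings (suc s)`.
  extensions-w₁ : ∀ m e e′ → extensions (suc m) (w₁ e , w₁ e′) ≡
    antidiagonal m λ s t → crossings s t e ℕ.* crossings s t e′
  extensions-w₁ zero    e e′ = extensions-w₁-suc 0 e e′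
  extensions-w₁ (suc m) e e′ = begin
    extensions (suc (suc m)) (w₁ e , w₁ e′)
      ≡⟨ extensions-w₁-suc (suc m) e e′ ⟩
    extensions (suc m) (w₁ e , w₁ e′) ℕ.+ extensions (suc m) (w₁ e , w₁ (suc e′))
      ℕ.+ (extensions (suc m) (w₁ (suc e) , w₁ e′) ℕ.+ extensions (suc m) (w₁ (suc e) , w₁ (suc e′)))
      ℕ.+ corner
      ≡⟨ cong (ℕ._+ corner) (cong₂ ℕ._+_
           (cong₂ ℕ._+_ (extensions-w₁ m e e′) (extensions-w₁ m e (suc e′)))
           (cong₂ ℕ._+_ (extensions-w₁ m (suc e) e′) (extensions-w₁ m (suc e) (suc e′)))) ⟩
    antidiagonal m (X e e′) ℕ.+ antidiagonal m (X e (suc e′))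
      ℕ.+ (antidiagonal m (X (suc e) e′) ℕ.+ antidiagonal m (X (suc e) (suc e′))) ℕ.+ corner
      ≡⟨ cong (ℕ._+ corner) (cong₂ ℕ._+_ (antidiagonal-+ m (X e e′) (X e (suc e′)))
           (antidiagonal-+ m (X (suc e) e′) (X (suc e) (suc e′)))) ⟨
    antidiagonal m (λ s t → X e e′ s t ℕ.+ X e (suc e′) s t)
      ℕ.+ antidiagonal m (λ s t → X (suc e) e′ s t ℕ.+ X (suc e) (suc e′) s t) ℕ.+ corner
      ≡⟨ cong (ℕ._+ corner) (antidiagonal-+ m (λ s t → X e e′ s t ℕ.+ X e (suc e′) s t) _) ⟨
    antidiagonal m (λ s t → X e e′ s t ℕ.+ X e (suc e′) s t ℕ.+ (X (suc e) e′ s t ℕ.+ X (suc e) (suc e′) s t))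
      ℕ.+ corner
      ≡⟨ cong (ℕ._+ corner) (antidiagonal-cong m λ s t → expand (crossings s t e) (crossings s t (suc e))
           (crossings s t e′) (crossings s t (suc e′))) ⟩
    antidiagonal m (X′ e e′) ℕ.+ corner ∎
    where
    corner = crossings 0 (suc m) e ℕ.* crossings 0 (suc m) e′
    X X′ : ℕ → ℕ → ℕ → ℕ → ℕ
    X  e e′ s t = crossings s t e ℕ.* crossings s t e′
    X′ e e′ s t = crossings (suc s) t e ℕ.* crossings (suc s) t e′
    expand : ∀ p q r s → p ℕ.* r ℕ.+ p ℕ.* s ℕ.+ (q ℕ.* r ℕ.+ q ℕ.* s) ≡ (p ℕ.+ q) ℕ.* (r ℕ.+ s)
    expand = ℕ-Solver.solve-∀

  antidiagonal-Σ≤ : ∀ m {g : ℕ → ℕ → ℕ} {h : ℕ → ℤ} → (∀ s t → s ℕ.+ t ≡ m → + g s t ≡ h t) →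
                    + antidiagonal m g ≡ Σ≤ m h
  antidiagonal-Σ≤ zero    g≡h = g≡h 0 0 refl
  antidiagonal-Σ≤ (suc m) g≡h =
    cong₂ _+_ (antidiagonal-Σ≤ m λ s t eq → g≡h (suc s) t (cong suc eq)) (g≡h 0 (suc m) refl)

  crossings-T : ∀ s t → + crossings s t 0 ≡ T (suc (s ℕ.+ t)) t
  crossings-T s t = begin
    + crossings s t 0                       ≡⟨ cong +_ (crossings-walks s t 0) ⟩
    + walks (suc (double t ℕ.+ s)) (suc s)  ≡⟨ walks-T _ t (suc s) length≡ ⟩
    T (t ℕ.+ suc s) t                       ≡⟨ cong (λ x → T x t) (ℕ.+-comm t (suc s)) ⟩
    T (suc (s ℕ.+ t)) t                     ∎
    where
    length≡ : suc (double t ℕ.+ s) ≡ t ℕ.+ t ℕ.+ suc s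
    length≡ = trans (cong (λ x → suc (x ℕ.+ s)) (double-+ t)) (sym (ℕ.+-suc (t ℕ.+ t) s))

  extensions-P : ∀ m → + extensions m (w₁ 0 , w₁ 0) ≡ P m
  extensions-P zero    = refl
  extensions-P (suc m) = begin
    + extensions (suc m) (w₁ 0 , w₁ 0)
      ≡⟨ cong +_ (extensions-w₁ m 0 0) ⟩
    + antidiagonal m (λ s t → crossings s t 0 ℕ.* crossings s t 0)
      ≡⟨ antidiagonal-Σ≤ m square ⟩
    Σ≤ m (λ t → T (suc m) t * T (suc m) t)
      ≡⟨ ℤ.+-identityʳ _ ⟨
    Σ≤ m (λ t → T (suc m) t * T (suc m) t) + 0ℤ
      ≡⟨ cong (λ x → Σ≤ m (λ t → T (suc m) t * T (suc m) t) + x * x) (T-diag (suc m)) ⟨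
    P (suc m) ∎
    where
    square : ∀ s t → s ℕ.+ t ≡ m → + (crossings s t 0 ℕ.* crossings s t 0) ≡ T (suc m) t * T (suc m) t
    square s t refl = trans (ℤ.pos-* (crossings s t 0) (crossings s t 0))
                            (cong (λ x → x * x) (crossings-T s t))

  extensions-S : ∀ m → + extensions m (w₂ , w₂) ≡ S m
  extensions-S zero    = refl
  extensions-S (suc m) = cong₂ _+_ (extensions-S m)
    (trans (cong +_ (ℕ.+-identityʳ (extensions m (w₁ 0 , w₁ 0)))) (extensions-P m))

  -- Triangles

  Step : ℕ → ℕ → Set
  Step x y = y ≡ x ⊎ y ≡ suc x

  tail : Word → Word
  tail w₂           = w₂
  tail (w₁ zero)    = w₂
  tail (w₁ (suc e)) = w₁ e
  tail (w₀ zero D)  = w₁ D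
  tail (w₀ (suc x) D) = w₀ x D

  letter : Word → ℕ → ℕ
  letter h zero    = head h
  letter h (suc t) = letter (tail h) t

  head-tail : ∀ h → Step (head h) (head (tail h))
  head-tail w₂             = inj₁ refl
  head-tail (w₁ zero)      = inj₂ refl
  head-tail (w₁ (suc e))   = inj₁ refl
  head-tail (w₀ zero D)    = inj₂ refl
  head-tail (w₀ (suc x) D) = inj₁ refl

  letter-step : ∀ h t → Step (letter h t) (letter h (suc t))
  letter-step h zero    = head-tail h
  letter-step h (suc t) = letter-step (tail h) t

  letter≤2 : ∀ h t → letter h t ℕ.≤ 2
  letter≤2 w₂       zero    = ℕ.≤-refl
  letter≤2 (w₁ _)   zero    = s≤s z≤n
  letter≤2 (w₀ _ _) zero    = z≤n
  letter≤2 h       (suc t) = letter≤2 (tail h) t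

  pattern 1st = here refl
  pattern 2nd = there (here refl)
  pattern 3rd = there (there (here refl))
  pattern 4th = there (there (there (here refl)))

  -- Column h begins one row above its right neighbour k, so letter t of k lies in the row of letter
  -- t + 1 of h. The two conditions are the diagonal and the horizontal rule at the top of k.
  Interlaced : Word → Word → Set
  Interlaced k h = Step (head h) (head k) × Step (head k) (head (tail h))

  succs-interlaced : ∀ k → All (Interlaced k) (succs k)
  succs-interlaced w₂ = (inj₁ refl , inj₁ refl) ∷ (inj₂ refl , inj₁ refl) ∷ []
  succs-interlaced (w₁ zero) =
    (inj₁ refl , inj₂ refl) ∷ (inj₁ refl , inj₁ refl) ∷ (inj₂ refl , inj₁ refl) ∷ []
  succs-interlaced (w₁ (suc e)) =
    (inj₁ refl , inj₁ refl) ∷ (inj₁ refl , inj₁ refl) ∷ (inj₂ refl , inj₁ refl) ∷ (inj₂ refl , inj₁ refl) ∷ []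
  succs-interlaced (w₀ zero zero) =
    (inj₁ refl , inj₂ refl) ∷ (inj₁ refl , inj₁ refl) ∷ (inj₁ refl , inj₂ refl) ∷ []
  succs-interlaced (w₀ zero (suc D)) =
    (inj₁ refl , inj₂ refl) ∷ (inj₁ refl , inj₁ refl) ∷ (inj₁ refl , inj₂ refl) ∷ (inj₁ refl , inj₁ refl) ∷ []
  succs-interlaced (w₀ (suc x) zero) =
    (inj₁ refl , inj₁ refl) ∷ (inj₁ refl , inj₁ refl) ∷ (inj₁ refl , inj₁ refl) ∷ []
  succs-interlaced (w₀ (suc x) (suc D)) =
    (inj₁ refl , inj₁ refl) ∷ (inj₁ refl , inj₁ refl) ∷ (inj₁ refl , inj₁ refl) ∷ (inj₁ refl , inj₁ refl) ∷ []

  -- Closure under removal of the top letters carries the condition on the heads to every row.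
  succs-tail : ∀ k → All (λ h → tail h ∈ succs (tail k)) (succs k)
  succs-tail w₂                   = 1st ∷ 1st ∷ []
  succs-tail (w₁ zero)            = 1st ∷ 2nd ∷ 2nd ∷ []
  succs-tail (w₁ (suc zero))      = 1st ∷ 2nd ∷ 1st ∷ 2nd ∷ []
  succs-tail (w₁ (suc (suc e)))   = 1st ∷ 2nd ∷ 1st ∷ 2nd ∷ []
  succs-tail (w₀ zero zero)       = 1st ∷ 3rd ∷ 2nd ∷ []
  succs-tail (w₀ zero (suc D))    = 1st ∷ 4th ∷ 2nd ∷ 3rd ∷ []
  succs-tail (w₀ (suc x) zero)    = 1st ∷ 2nd ∷ 3rd ∷ []
  succs-tail (w₀ (suc x) (suc D)) = 1st ∷ 2nd ∷ 3rd ∷ 4th ∷ []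

  interlaced : ∀ {h k} → h ∈ succs k → Interlaced k h
  interlaced {k = k} = All.lookup (succs-interlaced k)

  letter-interlaced : ∀ {h k} → h ∈ succs k → ∀ t →
                      Step (letter h t) (letter k t) × Step (letter k t) (letter h (suc t))
  letter-interlaced         h∈ zero    = interlaced h∈
  letter-interlaced {k = k} h∈ (suc t) = letter-interlaced (All.lookup (succs-tail k) h∈) t

  -- The converse of `succs-interlaced` and `succs-tail` together. Excluded pairs fail at the heads,
  -- or else their tails would violate `Interlaced` or lie outside the list.
  ∈-succs : ∀ h k → tail h ∈ succs (tail k) → Interlaced k h → h ∈ succs k
  ∈-succs w₂       w₂       _ _ = 1st
  ∈-succs w₂       (w₁ _)   _ (inj₁ () , _)
  ∈-succs w₂       (w₁ _)   _ (inj₂ () , _)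
  ∈-succs w₂       (w₀ _ _) _ (inj₁ () , _)
  ∈-succs w₂       (w₀ _ _) _ (inj₂ () , _)
  ∈-succs (w₁ zero) w₂        _ _ = 2nd
  ∈-succs (w₁ zero) (w₁ zero) _ _ = 1st
  ∈-succs (w₁ zero) (w₁ (suc e)) h∈ _ with interlaced {k = w₁ e} h∈
  ... | inj₁ () , _
  ... | inj₂ () , _
  ∈-succs (w₁ (suc _)) w₂     _ (_ , inj₁ ())
  ∈-succs (w₁ (suc _)) w₂     _ (_ , inj₂ ())
  ∈-succs (w₁ (suc _)) (w₁ zero) 2nd _ = 2nd
  ∈-succs (w₁ (suc _)) (w₁ (suc zero)) 1st _ = 1st
  ∈-succs (w₁ (suc _)) (w₁ (suc zero)) 2nd _ = 2nd
  ∈-succs (w₁ (suc _)) (w₁ (suc zero)) (there (there (there ()))) _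
  ∈-succs (w₁ (suc _)) (w₁ (suc (suc _))) 1st _ = 1st
  ∈-succs (w₁ (suc _)) (w₁ (suc (suc _))) 2nd _ = 2nd
  ∈-succs (w₁ (suc _)) (w₁ (suc (suc _))) (there (there (there (there ())))) _
  ∈-succs (w₁ _)   (w₀ _ _) _ (inj₁ () , _)
  ∈-succs (w₁ _)   (w₀ _ _) _ (inj₂ () , _)
  ∈-succs (w₀ _ _) w₂       _ (inj₁ () , _)
  ∈-succs (w₀ _ _) w₂       _ (inj₂ () , _)
  ∈-succs (w₀ zero _) (w₁ zero) 2nd _ = 3rd
  ∈-succs (w₀ zero _) (w₁ (suc zero)) 1st _ = 3rd
  ∈-succs (w₀ zero _) (w₁ (suc zero)) 2nd _ = 4th
  ∈-succs (w₀ zero _) (w₁ (suc zero)) (there (there (there ()))) _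
  ∈-succs (w₀ zero _) (w₁ (suc (suc _))) 1st _ = 3rd
  ∈-succs (w₀ zero _) (w₁ (suc (suc _))) 2nd _ = 4th
  ∈-succs (w₀ zero _) (w₁ (suc (suc _))) (there (there (there (there ())))) _
  ∈-succs (w₀ zero _) (w₀ zero zero) 1st _ = 1st
  ∈-succs (w₀ zero _) (w₀ zero zero) 2nd _ = 3rd
  ∈-succs (w₀ zero _) (w₀ zero zero) (there (there (there ()))) _
  ∈-succs (w₀ zero _) (w₀ zero (suc _)) 1st _ = 1st
  ∈-succs (w₀ zero _) (w₀ zero (suc _)) 2nd _ = 3rd
  ∈-succs (w₀ zero _) (w₀ zero (suc _)) (there (there (there (there ())))) _
  ∈-succs (w₀ zero _) (w₀ (suc x) D) h∈ _ with interlaced {k = w₀ x D} h∈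
  ... | inj₁ () , _
  ... | inj₂ () , _
  ∈-succs (w₀ (suc _) _) (w₁ _) _ (_ , inj₁ ())
  ∈-succs (w₀ (suc _) _) (w₁ _) _ (_ , inj₂ ())
  ∈-succs (w₀ (suc _) _) (w₀ zero zero) 3rd _ = 2nd
  ∈-succs (w₀ (suc _) _) (w₀ zero (suc _)) 3rd _ = 4th
  ∈-succs (w₀ (suc _) _) (w₀ zero (suc _)) 4th _ = 2nd
  ∈-succs (w₀ (suc _) _) (w₀ (suc _) zero) 1st _ = 1st
  ∈-succs (w₀ (suc _) _) (w₀ (suc _) zero) 2nd _ = 2nd
  ∈-succs (w₀ (suc _) _) (w₀ (suc _) zero) 3rd _ = 3rd
  ∈-succs (w₀ (suc _) _) (w₀ (suc _) (suc _)) 1st _ = 1st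
  ∈-succs (w₀ (suc _) _) (w₀ (suc _) (suc _)) 2nd _ = 2nd
  ∈-succs (w₀ (suc _) _) (w₀ (suc _) (suc _)) 3rd _ = 3rd
  ∈-succs (w₀ (suc _) _) (w₀ (suc _) (suc _)) 4th _ = 4th

  head≡2 : ∀ h → head h ≡ 2 → h ≡ w₂
  head≡2 w₂ _ = refl

  -- Both columns read 2 in the last row, so both words are `w₂` from there on and finitely many
  -- letters decide membership.
  letter-∈-succs : ∀ n h k → letter k n ≡ 2 → letter h (suc n) ≡ 2 →
    (∀ (t : Fin (suc n)) → Step (letter h (toℕ t)) (letter k (toℕ t))) →
    (∀ (t : Fin (suc n)) → Step (letter k (toℕ t)) (letter h (suc (toℕ t)))) →
    h ∈ succs k
  letter-∈-succs zero h k k-end h-end h≤k k≤h with refl ← head≡2 k k-end =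
    ∈-succs h w₂ (subst (_∈ succs w₂) (sym (head≡2 (tail h) h-end)) 1st) (h≤k zero , k≤h zero)
  letter-∈-succs (suc n) h k k-end h-end h≤k k≤h =
    ∈-succs h k (letter-∈-succs n (tail h) (tail k) k-end h-end (h≤k ∘ suc) (k≤h ∘ suc))
      (h≤k zero , k≤h zero)

  uncons-injective : ∀ h k → head h ≡ head k → tail h ≡ tail k → h ≡ k
  uncons-injective w₂             w₂             _ _    = refl
  uncons-injective (w₁ zero)      (w₁ zero)      _ _    = refl
  uncons-injective (w₁ (suc _))   (w₁ (suc _))   _ refl = refl
  uncons-injective (w₀ zero _)    (w₀ zero _)    _ refl = refl
  uncons-injective (w₀ (suc _) _) (w₀ (suc _) _) _ refl = refl
  uncons-injective (w₁ zero)      (w₁ (suc _))   _ ()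
  uncons-injective (w₁ (suc _))   (w₁ zero)      _ ()
  uncons-injective (w₀ zero _)    (w₀ (suc _) _) _ ()
  uncons-injective (w₀ (suc _) _) (w₀ zero _)    _ ()

  letter-injective : ∀ n h k → letter h n ≡ 2 →
    (∀ (t : Fin (suc n)) → letter h (toℕ t) ≡ letter k (toℕ t)) → h ≡ k
  letter-injective zero    h k h-end h≗k with refl ← head≡2 h h-end =
    sym (head≡2 k (sym (h≗k zero)))
  letter-injective (suc n) h k h-end h≗k =
    uncons-injective h k (h≗k zero) (letter-injective n (tail h) (tail k) h-end (h≗k ∘ suc))

  cons : ∀ x h → Step x (head h) → ∃ λ h′ → head h′ ≡ x × tail h′ ≡ h
  cons x w₂       (inj₁ refl) = w₂ , refl , refl
  cons x w₂       (inj₂ refl) = w₁ 0 , refl , refl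
  cons x (w₁ e)   (inj₁ refl) = w₁ (suc e) , refl , refl
  cons x (w₁ e)   (inj₂ refl) = w₀ 0 e , refl , refl
  cons x (w₀ y D) (inj₁ refl) = w₀ (suc y) D , refl , refl

  word : ∀ n (g : Fin (suc n) → ℕ) → (∀ i i′ → toℕ i ≡ suc (toℕ i′) → Step (g i′) (g i)) →
         g (fromℕ n) ≡ 2 → ∃ λ h → ∀ i → g i ≡ letter h (toℕ i)
  word zero    g steps end = w₂ , λ { zero → end }
  word (suc n) g steps end with word n (g ∘ suc) (λ i i′ eq → steps (suc i) (suc i′) (cong suc eq)) end
  ... | h , g≗h with cons (g zero) h (subst (Step (g zero)) (g≗h zero) (steps (suc zero) zero refl))
  ...   | h′ , head≡ , refl = h′ , λ { zero → sym head≡ ; (suc i) → g≗h i }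

  -- Below the diagonal max(i, j) is the row index. It rises by one along vertical and diagonal
  -- steps, so d grows in the direction of the step; along a row it is constant, so d grows from
  -- right to left.
  record TriangleRules {n} (d : Fin n → Fin n → ℕ) : Set where
    field
      vertical   : ∀ i i′ j → toℕ i ≡ suc (toℕ i′) → toℕ j ℕ.≤ toℕ i′ → Step (d i′ j) (d i j)
      horizontal : ∀ i j j′ → toℕ j ≡ suc (toℕ j′) → toℕ j ℕ.≤ toℕ i → Step (d i j) (d i j′)
      diagonal   : ∀ i i′ j j′ → toℕ i ≡ suc (toℕ i′) → toℕ j ≡ suc (toℕ j′) → toℕ j ℕ.≤ toℕ i →
                   Step (d i′ j′) (d i j)

  triangleRules-cong : ∀ {n} {d e : Fin n → Fin n → ℕ} → (∀ i j → toℕ j ℕ.≤ toℕ i → d i j ≡ e i j) →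
                   TriangleRules d → TriangleRules e
  triangleRules-cong d≗e rules = record
    { vertical = λ i i′ j eq j≤i′ → subst₂ Step (d≗e i′ j j≤i′)
        (d≗e i j (ℕ.≤-trans j≤i′ (ℕ.<⇒≤ (ℕ.≤-reflexive (sym eq))))) (vertical i i′ j eq j≤i′)
    ; horizontal = λ i j j′ eq j≤i → subst₂ Step (d≗e i j j≤i)
        (d≗e i j′ (ℕ.≤-trans (ℕ.<⇒≤ (ℕ.≤-reflexive (sym eq))) j≤i)) (horizontal i j j′ eq j≤i)
    ; diagonal = λ i i′ j j′ eq eq′ j≤i → subst₂ Step
        (d≗e i′ j′ (ℕ.≤-pred (subst₂ ℕ._≤_ eq′ eq j≤i))) (d≗e i j j≤i) (diagonal i i′ j j′ eq eq′ j≤i)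
    }
    where open TriangleRules rules

  -- The columns of a lower triangle are the words hs; the value is junk for j > i.
  low : ∀ {n} → Vec Word n → Fin n → Fin n → ℕ
  low (h ∷ hs) i       zero    = letter h (toℕ i)
  low (h ∷ hs) zero    (suc j) = 0
  low (h ∷ hs) (suc i) (suc j) = low hs i j

  data Triangle : ∀ {n} → Vec Word (suc n) → Set where
    [w₂] : Triangle (w₂ ∷ [])
    _∷_ : ∀ {n h k} {ks : Vec Word n} → h ∈ succs k → Triangle (k ∷ ks) → Triangle (h ∷ k ∷ ks)

  low-rules : ∀ {n} {hs : Vec Word (suc n)} → Triangle hs → TriangleRules (low hs)
  low-rules chain = record
    { vertical = vertical chain ; horizontal = horizontal chain ; diagonal = diagonal chain }
    where
    vertical : ∀ {n} {hs : Vec Word (suc n)} → Triangle hs → ∀ i i′ j →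
               toℕ i ≡ suc (toℕ i′) → toℕ j ℕ.≤ toℕ i′ → Step (low hs i′ j) (low hs i j)
    vertical {hs = h ∷ _} _ i i′ zero eq j≤i′ =
      subst (λ t → Step (letter h (toℕ i′)) (letter h t)) (sym eq) (letter-step h (toℕ i′))
    vertical (_ ∷ chain) (suc i) (suc i′) (suc j) eq (s≤s j≤i′) = vertical chain i i′ j (ℕ.suc-injective eq) j≤i′
    horizontal : ∀ {n} {hs : Vec Word (suc n)} → Triangle hs → ∀ i j j′ →
                 toℕ j ≡ suc (toℕ j′) → toℕ j ℕ.≤ toℕ i → Step (low hs i j) (low hs i j′)
    horizontal (h∈ ∷ _) (suc i) (suc zero) zero eq j≤i = proj₂ (letter-interlaced h∈ (toℕ i))
    horizontal (_ ∷ chain) (suc i) (suc j) (suc j′) eq (s≤s j≤i) = horizontal chain i j j′ (ℕ.suc-injective eq) j≤i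
    diagonal : ∀ {n} {hs : Vec Word (suc n)} → Triangle hs → ∀ i i′ j j′ →
               toℕ i ≡ suc (toℕ i′) → toℕ j ≡ suc (toℕ j′) → toℕ j ℕ.≤ toℕ i → Step (low hs i′ j′) (low hs i j)
    diagonal {hs = h ∷ k ∷ _} (h∈ ∷ _) (suc i) i′ (suc zero) zero eq eq′ j≤i =
      subst (λ t → Step (letter h t) (letter k (toℕ i))) (ℕ.suc-injective eq)
        (proj₁ (letter-interlaced h∈ (toℕ i)))
    diagonal (_ ∷ _) (suc zero) zero (suc (suc _)) (suc _) _ _ (s≤s ())
    diagonal (_ ∷ _) (suc (suc _)) zero (suc (suc _)) (suc _) () _ _
    diagonal (_ ∷ chain) (suc i) (suc i′) (suc j) (suc j′) eq eq′ (s≤s j≤i) =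
      diagonal chain i i′ j j′ (ℕ.suc-injective eq) (ℕ.suc-injective eq′) j≤i

  low≤2 : ∀ {n} (hs : Vec Word n) i j → low hs i j ℕ.≤ 2
  low≤2 (h ∷ hs) i       zero    = letter≤2 h (toℕ i)
  low≤2 (h ∷ hs) zero    (suc j) = z≤n
  low≤2 (h ∷ hs) (suc i) (suc j) = low≤2 hs i j

  low-corner : ∀ {n} {hs : Vec Word (suc n)} → Triangle hs → low hs (fromℕ n) (fromℕ n) ≡ 2
  low-corner [w₂]        = refl
  low-corner (_ ∷ chain) = low-corner chain

  low-diag : ∀ {n} (hs : Vec Word n) i → low hs i i ≡ head (lookup hs i)
  low-diag (h ∷ hs) zero    = refl
  low-diag (h ∷ hs) (suc i) = low-diag hs i

  2-step : ∀ {x y} → x ≡ 2 → y ℕ.≤ 2 → Step x y → y ≡ 2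
  2-step refl _ (inj₁ eq) = eq
  2-step refl (s≤s (s≤s ())) (inj₂ refl)

  -- Along the bottom row d grows leftwards from the corner value 2 and cannot exceed 2. This makes
  -- infinite words a faithful encoding of finite columns.
  triangle-end : ∀ {n} {hs : Vec Word (suc n)} → Triangle hs → letter (Vec.head hs) n ≡ 2
  triangle-end [w₂] = refl
  triangle-end {suc n} {h ∷ _} (h∈ ∷ chain) =
    2-step (triangle-end chain) (letter≤2 h (suc n)) (proj₂ (letter-interlaced h∈ n))

  low-injective : ∀ {n} {hs ks : Vec Word (suc n)} → Triangle hs → Triangle ks →
    (∀ i j → toℕ j ℕ.≤ toℕ i → low hs i j ≡ low ks i j) → hs ≡ ks
  low-injective [w₂] [w₂] _ = refl
  low-injective {suc n} {h ∷ _} {k ∷ _} chain₁@(_ ∷ hs) (_ ∷ ks) eq = cong₂ _∷_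
    (letter-injective (suc n) h k (triangle-end chain₁) (λ t → eq t zero z≤n))
    (low-injective hs ks (λ i j j≤i → eq (suc i) (suc j) (s≤s j≤i)))

  -- The bottom left entry is part of the conclusion so that the induction closes: it forces the
  -- value 2 at the bottom of the next column to the left, as `word` and `letter-∈-succs` require.
  low-surjective : ∀ n (d : Fin (suc n) → Fin (suc n) → ℕ) → TriangleRules d → (∀ i j → d i j ℕ.≤ 2) →
    d (fromℕ n) (fromℕ n) ≡ 2 →
    d (fromℕ n) zero ≡ 2 ×
    ∃ λ hs → Triangle hs × (∀ i j → toℕ j ℕ.≤ toℕ i → d i j ≡ low hs i j)
  low-surjective zero    d rules d≤2 end = end , w₂ ∷ [] , [w₂] , λ { zero zero _ → end }
  low-surjective (suc n) d rules d≤2 end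
    with low-surjective n (λ i j → d (suc i) (suc j))
      (record { vertical = λ i i′ j eq j≤i′ → vertical (suc i) (suc i′) (suc j) (cong suc eq) (s≤s j≤i′)
              ; horizontal = λ i j j′ eq j≤i → horizontal (suc i) (suc j) (suc j′) (cong suc eq) (s≤s j≤i)
              ; diagonal = λ i i′ j j′ eq eq′ j≤i →
                  diagonal (suc i) (suc i′) (suc j) (suc j′) (cong suc eq) (cong suc eq′) (s≤s j≤i)
              })
      (λ i j → d≤2 (suc i) (suc j)) end
    where open TriangleRules rules
  ... | k-end , ks@(k ∷ _) , chain , d≗ks
    with 2-step k-end (d≤2 (fromℕ (suc n)) zero)
           (TriangleRules.horizontal rules (fromℕ (suc n)) (suc zero) zero refl (s≤s z≤n))
  ... | h-end with word (suc n) (λ i → d i zero) (λ i i′ eq → TriangleRules.vertical rules i i′ zero eq z≤n) h-end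
  ... | h , d≗h = h-end , h ∷ ks , h∈ ∷ chain ,
    λ { i zero _ → d≗h i ; (suc i) (suc j) (s≤s j≤i) → d≗ks i j j≤i }
    where
    open TriangleRules rules
    h∈ : h ∈ succs k
    h∈ = letter-∈-succs n h k
      (trans (trans (cong (letter k) (sym (Fin.toℕ-fromℕ n))) (sym (d≗ks (fromℕ n) zero z≤n))) k-end)
      (trans (trans (cong (letter h ∘ suc) (sym (Fin.toℕ-fromℕ n))) (sym (d≗h (fromℕ (suc n))))) h-end)
      (λ t → subst₂ Step (trans (d≗h (inject₁ t)) (cong (letter h) (Fin.toℕ-inject₁ t))) (d≗ks t zero z≤n)
        (diagonal (suc t) (inject₁ t) (suc zero) zero (cong suc (sym (Fin.toℕ-inject₁ t))) refl (s≤s z≤n)))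
      (λ t → subst₂ Step (d≗ks t zero z≤n) (d≗h (suc t)) (horizontal (suc t) (suc zero) zero refl (s≤s z≤n)))

  -- Legal arrays

  cancel-top : ∀ m {x y} → m - x ≡ m - y → x ≡ y
  cancel-top m {x} {y} eq = begin
    x             ≡⟨ lemma m x ⟩
    m - (m - x)   ≡⟨ cong (λ z → m - z) eq ⟩
    m - (m - y)   ≡⟨ lemma m y ⟨
    y             ∎
    where
    lemma : ∀ m x → x ≡ m - (m - x)
    lemma = solve-∀

  -- The `level` lemmas serve neighbours with equal max(i, j), the `rise` lemmas those where it
  -- increases by one. Passing from entries to deficits reverses the direction of growth only in the
  -- former case.
  level⁺ : ∀ {m x y} → EqualsOrOneMoreThan (+ m - + x) (+ m - + y) → Step x y
  level⁺ {m} (inj₁ eq) = inj₁ (sym (ℤ.+-injective (cancel-top (+ m) eq)))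
  level⁺ {m} {x} {y} (inj₂ eq) = inj₂ (sym (ℤ.+-injective (cancel-top (+ m) (trans (lemma (+ m) (+ x))
    (trans (cong (λ z → z - 1ℤ) eq) (lemma′ (+ m) (+ y)))))))
    where
    lemma : ∀ m x → m - (1ℤ + x) ≡ m - x - 1ℤ
    lemma = solve-∀
    lemma′ : ∀ m y → m - y + 1ℤ - 1ℤ ≡ m - y
    lemma′ = solve-∀

  level⁻ : ∀ {m x y} → Step x y → EqualsOrOneMoreThan (+ m - + x) (+ m - + y)
  level⁻ (inj₁ refl) = inj₁ refl
  level⁻ {m} {x} (inj₂ refl) = inj₂ (lemma (+ m) (+ x))
    where
    lemma : ∀ m x → m - x ≡ m - (1ℤ + x) + 1ℤ
    lemma = solve-∀

  rise⁺ : ∀ {m x y} → EqualsOrOneMoreThan (+ suc m - + x) (+ m - + y) → Step y x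
  rise⁺ {m} {x} {y} (inj₁ eq) = inj₂ (ℤ.+-injective (cancel-top (+ suc m) (trans eq (lemma (+ m) (+ y)))))
    where
    lemma : ∀ m y → m - y ≡ 1ℤ + m - (1ℤ + y)
    lemma = solve-∀
  rise⁺ {m} {x} {y} (inj₂ eq) = inj₁ (ℤ.+-injective (cancel-top (+ suc m) (trans eq (lemma (+ m) (+ y)))))
    where
    lemma : ∀ m y → m - y + 1ℤ ≡ 1ℤ + m - y
    lemma = solve-∀

  rise⁻ : ∀ {m x y} → Step y x → EqualsOrOneMoreThan (+ suc m - + x) (+ m - + y)
  rise⁻ {m} {y = y} (inj₁ refl) = inj₂ (lemma (+ m) (+ y))
    where
    lemma : ∀ m y → 1ℤ + m - y ≡ m - y + 1ℤ
    lemma = solve-∀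
  rise⁻ {m} {y = y} (inj₂ refl) = inj₁ (lemma (+ m) (+ y))
    where
    lemma : ∀ m y → 1ℤ + m - (1ℤ + y) ≡ m - y
    lemma = solve-∀

  record LocalRules {n} (z : Fin n → Fin n → ℤ) : Set where
    field
      vertical   : ∀ i i′ j → toℕ i ≡ suc (toℕ i′) → EqualsOrOneMoreThan (z i j) (z i′ j)
      horizontal : ∀ i j j′ → toℕ j ≡ suc (toℕ j′) → EqualsOrOneMoreThan (z i j) (z i j′)
      diagonal   : ∀ i i′ j j′ → toℕ i ≡ suc (toℕ i′) → toℕ j ≡ suc (toℕ j′) →
                   EqualsOrOneMoreThan (z i j) (z i′ j′)

  transpose : ∀ {n} {z : Fin n → Fin n → ℤ} → LocalRules z → LocalRules (flip z)
  transpose rules = record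
    { vertical   = λ i i′ j → horizontal j i i′
    ; horizontal = λ i j j′ → vertical j j′ i
    ; diagonal   = λ i i′ j j′ eq eq′ → diagonal j j′ i i′ eq′ eq
    }
    where open LocalRules rules

  -- The indices of Fin start from 0, so that toℕ i ⊔ toℕ j is the paper's max(i, j) − 1.
  Deficit : ∀ {n} → (Fin n → Fin n → ℤ) → (Fin n → Fin n → ℕ) → Set
  Deficit z d = ∀ i j → z i j ≡ + (toℕ i ⊔ toℕ j) - + d i j

  module _ {n} (z : Fin n → Fin n → ℤ) (d : Fin n → Fin n → ℕ) (deficit : Deficit z d) where

    transpose-deficit : Deficit (flip z) (flip d)
    transpose-deficit i j = trans (deficit j i) (cong (λ m → + m - + d j i) (ℕ.⊔-comm (toℕ j) (toℕ i)))

    deficit-below : ∀ i j {m} → toℕ i ≡ m → toℕ j ℕ.≤ m → z i j ≡ + m - + d i j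
    deficit-below i j refl j≤i = trans (deficit i j) (cong (λ m → + m - + d i j) (ℕ.m≥n⇒m⊔n≡m j≤i))

    deficit-above : ∀ i j {m} → toℕ j ≡ m → toℕ i ℕ.≤ m → z i j ≡ + m - + d i j
    deficit-above i j refl i≤j = trans (deficit i j) (cong (λ m → + m - + d i j) (ℕ.m≤n⇒m⊔n≡n i≤j))

    local⇒triangle : LocalRules z → TriangleRules d
    local⇒triangle rules = record
      { vertical = λ i i′ j eq j≤i′ → rise⁺ {toℕ i′} (subst₂ EqualsOrOneMoreThan
          (deficit-below i j eq (ℕ.m≤n⇒m≤1+n j≤i′)) (deficit-below i′ j refl j≤i′) (vertical i i′ j eq))
      ; horizontal = λ i j j′ eq j≤i → level⁺ {toℕ i} (subst₂ EqualsOrOneMoreThan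
          (deficit-below i j refl j≤i)
          (deficit-below i j′ refl (ℕ.<⇒≤ (subst (ℕ._≤ toℕ i) eq j≤i))) (horizontal i j j′ eq))
      ; diagonal = λ i i′ j j′ eq eq′ j≤i → rise⁺ {toℕ i′} (subst₂ EqualsOrOneMoreThan
          (deficit-below i j eq (subst (toℕ j ℕ.≤_) eq j≤i))
          (deficit-below i′ j′ refl (ℕ.≤-pred (subst₂ ℕ._≤_ eq′ eq j≤i))) (diagonal i i′ j j′ eq eq′))
      }
      where open LocalRules rules

  module _ {n} (z : Fin n → Fin n → ℤ) (d : Fin n → Fin n → ℕ) (deficit : Deficit z d)
           (lower : TriangleRules d) (upper : TriangleRules (flip d)) where

    -- On or above the diagonal the column index is the larger one, so a vertical step is a
    -- horizontal step of the transposed triangle.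
    triangle⇒vertical : ∀ i i′ j → toℕ i ≡ suc (toℕ i′) → EqualsOrOneMoreThan (z i j) (z i′ j)
    triangle⇒vertical i i′ j eq with toℕ j ℕ.≤? toℕ i′
    ... | yes j≤i′ = subst₂ EqualsOrOneMoreThan
      (sym (deficit-below z d deficit i j eq (ℕ.m≤n⇒m≤1+n j≤i′))) (sym (deficit-below z d deficit i′ j refl j≤i′))
      (rise⁻ {toℕ i′} (TriangleRules.vertical lower i i′ j eq j≤i′))
    ... | no j≰i′ = subst₂ EqualsOrOneMoreThan
      (sym (deficit-above z d deficit i j refl i≤j)) (sym (deficit-above z d deficit i′ j refl (ℕ.<⇒≤ (ℕ.≰⇒> j≰i′))))
      (level⁻ {toℕ j} (TriangleRules.horizontal upper j i i′ eq i≤j))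
      where
      i≤j : toℕ i ℕ.≤ toℕ j
      i≤j = subst (ℕ._≤ toℕ j) (sym eq) (ℕ.≰⇒> j≰i′)

    triangle⇒diagonal : ∀ i i′ j j′ → toℕ i ≡ suc (toℕ i′) → toℕ j ≡ suc (toℕ j′) →
                    EqualsOrOneMoreThan (z i j) (z i′ j′)
    triangle⇒diagonal i i′ j j′ eq eq′ = subst₂ EqualsOrOneMoreThan
      (sym (trans (deficit i j) (cong₂ (λ p q → + (p ⊔ q) - + d i j) eq eq′)))
      (sym (deficit i′ j′)) (rise⁻ {toℕ i′ ⊔ toℕ j′} step)
      where
      step : Step (d i′ j′) (d i j)
      step with ℕ.≤-total (toℕ j) (toℕ i)
      ... | inj₁ j≤i = TriangleRules.diagonal lower i i′ j j′ eq eq′ j≤i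
      ... | inj₂ i≤j = TriangleRules.diagonal upper j j′ i i′ eq′ eq i≤j

  triangle⇒local : ∀ {n} {z : Fin n → Fin n → ℤ} {d : Fin n → Fin n → ℕ} → Deficit z d →
               TriangleRules d → TriangleRules (flip d) → LocalRules z
  triangle⇒local {z = z} {d} deficit lower upper = record
    { vertical   = triangle⇒vertical z d deficit lower upper
    ; horizontal = λ i j j′ → triangle⇒vertical (flip z) (flip d) (transpose-deficit z d deficit) upper lower j j′ i
    ; diagonal   = triangle⇒diagonal z d deficit lower upper
    }

  legal⇒local : ∀ {n} {x : Array n n} → Legal 2 n n x → LocalRules (entry x)
  legal⇒local legal = record
    { vertical   = λ i i′ j eq → vertical i i′ j (cong suc eq)
    ; horizontal = λ i j j′ eq → horizontal i j j′ (cong suc eq)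
    ; diagonal   = λ i i′ j j′ eq eq′ → diagonal i i′ j j′ (cong suc eq) (cong suc eq′)
    }
    where open Legal legal

  oneMore≤ : ∀ {x y m} → EqualsOrOneMoreThan x y → y ℤ.≤ + m → x ℤ.≤ + suc m
  oneMore≤ {m = m} (inj₁ refl) y≤m = ℤ.≤-trans y≤m (+≤+ (ℕ.n≤1+n m))
  oneMore≤ {y = y} {m} (inj₂ refl) y≤m =
    subst (y + 1ℤ ℤ.≤_) (ℤ.+-comm (+ m) 1ℤ) (ℤ.+-monoˡ-≤ 1ℤ y≤m)

  pos-suc : ∀ {n} (i : Fin n) → pos (suc i) ≡ suc (pos (inject₁ i))
  pos-suc i = cong (λ m → suc (suc m)) (sym (Fin.toℕ-inject₁ i))

  module _ {n} {x : Array (suc n) (suc n)} (legal : Legal 2 (suc n) (suc n) x) where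
    open Legal legal

    -- Going diagonally as far as possible, one gets from the top left corner to the position in p ⊔
    -- q steps, each adding at most 1. Hence the deficit is nonnegative and equals the absolute
    -- value that `near` bounds.
    entry≤ : ∀ p q i j → toℕ i ≡ p → toℕ j ≡ q → entry x i j ℤ.≤ + (p ⊔ q)
    entry≤ zero    zero    i       j       eq eq′ = ℤ.≤-reflexive (topLeft i j (cong suc eq) (cong suc eq′))
    entry≤ (suc p) zero    (suc i) j       eq eq′ = oneMore≤
      (vertical (suc i) (inject₁ i) j (pos-suc i))
      (subst (λ m → entry x (inject₁ i) j ℤ.≤ + m) (ℕ.⊔-identityʳ p)
        (entry≤ p zero (inject₁ i) j (trans (Fin.toℕ-inject₁ i) (ℕ.suc-injective eq)) eq′))
    entry≤ zero    (suc q) i       (suc j) eq eq′ = oneMore≤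
      (horizontal i (suc j) (inject₁ j) (pos-suc j))
      (entry≤ zero q i (inject₁ j) eq (trans (Fin.toℕ-inject₁ j) (ℕ.suc-injective eq′)))
    entry≤ (suc p) (suc q) (suc i) (suc j) eq eq′ = oneMore≤
      (diagonal (suc i) (inject₁ i) (suc j) (inject₁ j) (pos-suc i)
        (pos-suc j))
      (entry≤ p q (inject₁ i) (inject₁ j) (trans (Fin.toℕ-inject₁ i) (ℕ.suc-injective eq))
        (trans (Fin.toℕ-inject₁ j) (ℕ.suc-injective eq′)))

    deficitOf : Fin (suc n) → Fin (suc n) → ℕ
    deficitOf i j = ℤ.∣ entry x i j - + (toℕ i ⊔ toℕ j) ∣

    legal⇒deficit : Deficit (entry x) deficitOf
    legal⇒deficit i j = begin
      entry x i j                                     ≡⟨ lemma (entry x i j) m ⟩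
      m - (m - entry x i j)                           ≡⟨ cong (λ y → m - y) (ℤ.0≤i⇒+∣i∣≡i nonneg) ⟨
      m - + ℤ.∣ m - entry x i j ∣                     ≡⟨ cong (λ y → m - + y) (ℤ.∣i-j∣≡∣j-i∣ m (entry x i j)) ⟩
      m - + deficitOf i j                             ∎
      where
      m = + (toℕ i ⊔ toℕ j)
      nonneg : 0ℤ ℤ.≤ m - entry x i j
      nonneg = ℤ.i≤j⇒0≤j-i (entry≤ (toℕ i) (toℕ j) i j refl refl)
      lemma : ∀ x m → x ≡ m - (m - x)
      lemma = solve-∀

    deficitOf≤2 : ∀ i j → deficitOf i j ℕ.≤ 2
    deficitOf≤2 = near

    deficitOf-start : deficitOf zero zero ≡ 0
    deficitOf-start = cong (λ y → ℤ.∣ y - 0ℤ ∣) (topLeft zero zero refl refl)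

    deficitOf-end : deficitOf (fromℕ n) (fromℕ n) ≡ 2
    deficitOf-end = ℤ.+-injective (cancel-top (+ n) (begin
      + n - + d                       ≡⟨ cong (λ m → + m - + d) last≡ ⟨
      + (toℕ l ⊔ toℕ l) - + d         ≡⟨ legal⇒deficit l l ⟨
      entry x l l                     ≡⟨ bottomRight l l (cong suc (Fin.toℕ-fromℕ n)) (cong suc (Fin.toℕ-fromℕ n)) ⟩
      + suc (n ⊔ n) - + 2 - 1ℤ        ≡⟨ cong (λ m → + suc m - + 2 - 1ℤ) (ℕ.⊔-idem n) ⟩
      + suc n - + 2 - 1ℤ              ≡⟨ lemma (+ n) ⟩
      + n - + 2                       ∎))
      where
      l = fromℕ n
      d = deficitOf l l
      last≡ : toℕ l ⊔ toℕ l ≡ n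
      last≡ = trans (ℕ.⊔-idem (toℕ l)) (Fin.toℕ-fromℕ n)
      lemma : ∀ n → 1ℤ + n - + 2 - 1ℤ ≡ n - + 2
      lemma = solve-∀

  deficit⇒legal : ∀ {n} {x : Array (suc n) (suc n)} {d} → Deficit (entry x) d →
    TriangleRules d → TriangleRules (flip d) → (∀ i j → d i j ℕ.≤ 2) →
    d zero zero ≡ 0 → d (fromℕ n) (fromℕ n) ≡ 2 → Legal 2 (suc n) (suc n) x
  deficit⇒legal {n} {x} {d} deficit lower upper d≤2 start end = record
    { topLeft     = λ { zero zero _ _ → trans (deficit zero zero) (cong (λ y → 0ℤ - + y) start) }
    ; bottomRight = corner
    ; vertical    = λ i i′ j eq → vertical i i′ j (ℕ.suc-injective eq)
    ; horizontal  = λ i j j′ eq → horizontal i j j′ (ℕ.suc-injective eq)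
    ; diagonal    = λ i i′ j j′ eq eq′ → diagonal i i′ j j′ (ℕ.suc-injective eq) (ℕ.suc-injective eq′)
    ; near        = λ i j → subst (ℕ._≤ 2) (sym (size i j)) (d≤2 i j)
    }
    where
    open LocalRules (triangle⇒local deficit lower upper)
    last≡ : ∀ i → pos i ≡ suc n → i ≡ fromℕ n
    last≡ i eq = Fin.toℕ-injective (trans (ℕ.suc-injective eq) (sym (Fin.toℕ-fromℕ n)))
    corner : ∀ i j → pos i ≡ suc n → pos j ≡ suc n → entry x i j ≡ + (suc n ⊔ suc n) - + 2 - 1ℤ
    corner i j eq eq′ with refl ← last≡ i eq | refl ← last≡ j eq′ = begin
      entry x l l                                   ≡⟨ deficit l l ⟩
      + (toℕ l ⊔ toℕ l) - + d l l                   ≡⟨ cong₂ (λ m y → + (m ⊔ m) - + y) (Fin.toℕ-fromℕ n) end ⟩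
      + (n ⊔ n) - + 2                               ≡⟨ lemma (+ (n ⊔ n)) ⟩
      + suc (n ⊔ n) - + 2 - 1ℤ                      ∎
      where
      l = fromℕ n
      lemma : ∀ n → n - + 2 ≡ 1ℤ + n - + 2 - 1ℤ
      lemma = solve-∀
    size : ∀ i j → ℤ.∣ entry x i j - (+ (pos i ⊔ pos j) - 1ℤ) ∣ ≡ d i j
    size i j = begin
      ℤ.∣ entry x i j - (1ℤ + m - 1ℤ) ∣     ≡⟨ cong (λ y → ℤ.∣ y - (1ℤ + m - 1ℤ) ∣) (deficit i j) ⟩
      ℤ.∣ m - + d i j - (1ℤ + m - 1ℤ) ∣     ≡⟨ cong ℤ.∣_∣ (lemma m (+ d i j)) ⟩
      ℤ.∣ - + d i j ∣                       ≡⟨ ℤ.∣-i∣≡∣i∣ (+ d i j) ⟩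
      d i j                                 ∎
      where
      m = + (toℕ i ⊔ toℕ j)
      lemma : ∀ m y → m - y - (1ℤ + m - 1ℤ) ≡ - y
      lemma = solve-∀

  -- Codes of legal arrays

  record Code {n} (v : Vec State (suc n)) : Set where
    field
      lower : Triangle (Vec.map proj₁ v)
      upper : Triangle (Vec.map proj₂ v)
      level : ∀ i → head (proj₁ (lookup v i)) ≡ head (proj₂ (lookup v i))

  extend : ∀ {n} → Vec State (suc n) → List (Vec State (suc (suc n)))
  extend v = map (_∷ v) (successors (Vec.head v))

  codes : ∀ n → List (Vec State (suc n))
  codes zero    = ((w₂ , w₂) ∷ []) ∷ []
  codes (suc n) = concatMap extend (codes n)

  ∈-successors⁻ : ∀ {h k h′ k′} → head h ≡ head k → (h′ , k′) ∈ successors (h , k) →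
                  h′ ∈ succs h × k′ ∈ succs k × head h′ ≡ head k′
  ∈-successors⁻ {h} {k} h≡k s∈ with ∈.∈-++⁻ (cartesianProduct (same h) (same k)) s∈
  ... | inj₁ s∈ with h∈ , k∈ ← ∈.∈-cartesianProduct⁻ (same h) (same k) s∈ =
    ∈.∈-++⁺ˡ h∈ , ∈.∈-++⁺ˡ k∈ ,
    trans (All.lookup (same-head h) h∈) (trans h≡k (sym (All.lookup (same-head k) k∈)))
  ... | inj₂ s∈ with h∈ , k∈ ← ∈.∈-cartesianProduct⁻ (up h) (up k) s∈ =
    ∈.∈-++⁺ʳ (same h) h∈ , ∈.∈-++⁺ʳ (same k) k∈ ,
    ℕ.suc-injective (trans (All.lookup (up-head h) h∈) (trans h≡k (sym (All.lookup (up-head k) k∈))))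

  ∈-successors⁺ : ∀ {h k h′ k′} → head h ≡ head k → head h′ ≡ head k′ →
                  h′ ∈ succs h → k′ ∈ succs k → (h′ , k′) ∈ successors (h , k)
  ∈-successors⁺ {h} {k} h≡k h′≡k′ h∈ k∈ with ∈.∈-++⁻ (same h) h∈ | ∈.∈-++⁻ (same k) k∈
  ... | inj₁ h∈ | inj₁ k∈ = ∈.∈-++⁺ˡ (∈.∈-cartesianProduct⁺ h∈ k∈)
  ... | inj₂ h∈ | inj₂ k∈ = ∈.∈-++⁺ʳ (cartesianProduct (same h) (same k)) (∈.∈-cartesianProduct⁺ h∈ k∈)
  -- One word would keep its diagonal letter and the other lower it, although the two triangles
  -- share the diagonal.
  ... | inj₁ h∈ | inj₂ k∈ = ⊥-elim (ℕ.1+n≢n (trans (All.lookup (up-head k) k∈)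
        (trans (sym h≡k) (trans (sym (All.lookup (same-head h) h∈)) h′≡k′))))
  ... | inj₂ h∈ | inj₁ k∈ = ⊥-elim (ℕ.1+n≢n (trans (All.lookup (up-head h) h∈)
        (trans h≡k (trans (sym (All.lookup (same-head k) k∈)) (sym h′≡k′)))))

  ∈-codes⁻ : ∀ n {v} → v ∈ codes n → Code v
  ∈-codes⁻ zero    (here refl) = record { lower = [w₂] ; upper = [w₂] ; level = λ { zero → refl } }
  ∈-codes⁻ (suc n) v∈ with find (∈.∈-concatMap⁻ extend {xs = codes n} v∈)
  ... | w@((h , k) ∷ _) , w∈ , v∈′ with _ , s∈ , refl ← ∈.∈-map⁻ (_∷ w) v∈′ =
    let open Code (∈-codes⁻ n w∈) ; (h∈ , k∈ , h′≡k′) = ∈-successors⁻ (level zero) s∈ in record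
    { lower = h∈ ∷ lower
    ; upper = k∈ ∷ upper
    ; level = λ { zero → h′≡k′ ; (suc i) → level i }
    }

  ∈-codes⁺ : ∀ n {v} → Code v → v ∈ codes n
  ∈-codes⁺ zero {(h , k) ∷ []} code with Code.lower code | Code.upper code
  ... | [w₂] | [w₂] = here refl
  ∈-codes⁺ (suc n) {(h , k) ∷ w@(_ ∷ _)} code with Code.lower code | Code.upper code
  ... | h∈ ∷ lower | k∈ ∷ upper =
    ∈.∈-concatMap⁺ extend (lose
      (∈-codes⁺ n (record { lower = lower ; upper = upper ; level = level ∘ suc }))
      (∈.∈-map⁺ (_∷ w) (∈-successors⁺ (level (suc zero)) (level zero) h∈ k∈)))
    where open Code code using (level)

  same-unique : ∀ h → Unique (same h)
  same-unique w₂             = [] ∷ []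
  same-unique (w₁ _)         = ((λ ()) ∷ []) ∷ [] ∷ []
  same-unique (w₀ _ zero)    = ((λ ()) ∷ (λ ()) ∷ []) ∷ ((λ ()) ∷ []) ∷ [] ∷ []
  same-unique (w₀ _ (suc _)) =
    ((λ ()) ∷ (λ ()) ∷ (λ ()) ∷ []) ∷ ((λ ()) ∷ (λ ()) ∷ []) ∷ ((λ ()) ∷ []) ∷ [] ∷ []

  up-unique : ∀ h → Unique (up h)
  up-unique w₂           = [] ∷ []
  up-unique (w₁ zero)    = [] ∷ []
  up-unique (w₁ (suc _)) = ((λ ()) ∷ []) ∷ [] ∷ []
  up-unique (w₀ _ _)     = []

  successors-unique : ∀ s → Unique (successors s)
  successors-unique (h , k) = Unique.++⁺
    (Unique.cartesianProduct⁺ (same-unique h) (same-unique k))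
    (Unique.cartesianProduct⁺ (up-unique h) (up-unique k))
    λ { (s∈ , s∈′) → ℕ.1+n≢n (trans
        (All.lookup (up-head h) (proj₁ (∈.∈-cartesianProduct⁻ (up h) (up k) s∈′)))
        (sym (All.lookup (same-head h) (proj₁ (∈.∈-cartesianProduct⁻ (same h) (same k) s∈))))) }

  codes-unique : ∀ n → Unique (codes n)
  codes-unique zero    = [] ∷ []
  codes-unique (suc n) = Unique.concat⁺
    (All.map⁺ (All.universal (λ v → Unique.map⁺ (λ { refl → refl }) (successors-unique (Vec.head v))) (codes n)))
    (AllPairs.map⁺ (AllPairs.map disjoint (codes-unique n)))
    where
    disjoint : ∀ {v w : Vec State (suc n)} → v ≢ w → Disjoint (extend v) (extend w)
    disjoint {v} {w} v≢w (u∈ , u∈′) with ∈.∈-map⁻ (_∷ v) u∈ | ∈.∈-map⁻ (_∷ w) u∈′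
    ... | _ , _ , refl | _ , _ , refl = v≢w refl

  Complete : ∀ {n} → Vec State (suc n) → Set
  Complete v = head (proj₁ (Vec.head v)) ≡ 0

  complete? : ∀ {n} → Decidable (Complete {n})
  complete? v = head (proj₁ (Vec.head v)) ℕ.≟ 0

  -- `codes` branches at its latest state, `extensions` at its initial one. With m columns still
  -- pending, each induction step moves one column from the enumerated to the pending ones.
  extensions-codes : ∀ n m → sum (map (λ v → extensions m (Vec.head v)) (codes n)) ≡ extensions (n ℕ.+ m) (w₂ , w₂)
  extensions-codes zero    m = ℕ.+-identityʳ (extensions m (w₂ , w₂))
  extensions-codes (suc n) m = begin
    sum (map (λ v → extensions m (Vec.head v)) (concatMap extend (codes n)))
      ≡⟨ flatten (codes n) ⟩
    sum (map (λ v → extensions (suc m) (Vec.head v)) (codes n))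
      ≡⟨ extensions-codes n (suc m) ⟩
    extensions (n ℕ.+ suc m) (w₂ , w₂)
      ≡⟨ cong (λ l → extensions l (w₂ , w₂)) (ℕ.+-suc n m) ⟩
    extensions (suc n ℕ.+ m) (w₂ , w₂) ∎
    where
    flatten : ∀ (vs : List (Vec State (suc n))) →
      sum (map (λ v → extensions m (Vec.head v)) (concatMap extend vs)) ≡
      sum (map (λ v → extensions (suc m) (Vec.head v)) vs)
    flatten []       = refl
    flatten (v ∷ vs) = begin
      sum (map (λ v → extensions m (Vec.head v)) (extend v ++ concatMap extend vs))
        ≡⟨ cong sum (map-++ _ (extend v) (concatMap extend vs)) ⟩
      sum (map (λ v → extensions m (Vec.head v)) (extend v) ++ _)
        ≡⟨ sum-++ (map (λ v → extensions m (Vec.head v)) (extend v)) _ ⟩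
      sum (map (λ v → extensions m (Vec.head v)) (extend v)) ℕ.+ _
        ≡⟨ cong₂ ℕ._+_ (cong sum (sym (map-∘ (successors (Vec.head v))))) (flatten vs) ⟩
      extensions (suc m) (Vec.head v) ℕ.+ sum (map (λ v → extensions (suc m) (Vec.head v)) vs) ∎

  complete-count : ∀ {n} (vs : List (Vec State (suc n))) →
    length (filter complete? vs) ≡ sum (map (λ v → extensions 0 (Vec.head v)) vs)
  complete-count []                        = refl
  complete-count (((w₀ _ _ , _) ∷ _) ∷ vs) = cong suc (complete-count vs)
  complete-count (((w₁ _ , _) ∷ _) ∷ vs)   = complete-count vs
  complete-count (((w₂ , _) ∷ _) ∷ vs)     = complete-count vs

  -- The diagonal is read from the lower words; `level` makes the upper words agree with it.
  shortfall : ∀ {n} → Vec State n → Fin n → Fin n → ℕ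
  shortfall ((h , k) ∷ v) zero    zero    = head h
  shortfall ((h , k) ∷ v) zero    (suc j) = letter k (suc (toℕ j))
  shortfall ((h , k) ∷ v) (suc i) zero    = letter h (suc (toℕ i))
  shortfall ((h , k) ∷ v) (suc i) (suc j) = shortfall v i j

  shortfall-lower : ∀ {n} (v : Vec State n) i j → toℕ j ℕ.≤ toℕ i → shortfall v i j ≡ low (Vec.map proj₁ v) i j
  shortfall-lower (_ ∷ v) zero    zero    _         = refl
  shortfall-lower (_ ∷ v) (suc i) zero    _         = refl
  shortfall-lower (_ ∷ v) (suc i) (suc j) (s≤s j≤i) = shortfall-lower v i j j≤i

  shortfall-upper : ∀ {n} (v : Vec State n) → (∀ i → head (proj₁ (lookup v i)) ≡ head (proj₂ (lookup v i))) →
              ∀ j i → toℕ i ℕ.≤ toℕ j → shortfall v i j ≡ low (Vec.map proj₂ v) j i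
  shortfall-upper (_ ∷ v) level zero    zero    _         = level zero
  shortfall-upper (_ ∷ v) level (suc j) zero    _         = refl
  shortfall-upper (_ ∷ v) level (suc j) (suc i) (s≤s i≤j) = shortfall-upper v (level ∘ suc) j i i≤j

  decode : ∀ {n} → Vec State n → Array n n
  decode v = tabulate λ i → tabulate λ j → + (toℕ i ⊔ toℕ j) - + shortfall v i j

  decode-deficit : ∀ {n} (v : Vec State n) → Deficit (entry (decode v)) (shortfall v)
  decode-deficit v i j = trans
    (cong (λ row → lookup row j) (Vec.lookup∘tabulate _ i))
    (Vec.lookup∘tabulate (λ j → + (toℕ i ⊔ toℕ j) - + shortfall v i j) j)

  array-ext : ∀ {n} {x y : Array n n} → (∀ i j → entry x i j ≡ entry y i j) → x ≡ y
  array-ext eq = vec-ext λ i → vec-ext (eq i)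
    where
    vec-ext : ∀ {A : Set} {n} {x y : Vec A n} → (∀ i → lookup x i ≡ lookup y i) → x ≡ y
    vec-ext {x = x} {y} eq = trans (sym (Vec.tabulate∘lookup x)) (trans (Vec.tabulate-cong eq) (Vec.tabulate∘lookup y))

  decode-legal : ∀ {n} {v : Vec State (suc n)} → Code v → Complete v → Legal 2 (suc n) (suc n) (decode v)
  decode-legal {n} {v@((w₀ _ _ , _) ∷ _)} code refl = deficit⇒legal (decode-deficit v)
    (triangleRules-cong (λ i j j≤i → sym (shortfall-lower v i j j≤i)) (low-rules lower))
    (triangleRules-cong (λ j i i≤j → sym (shortfall-upper v level j i i≤j)) (low-rules upper))
    shortfall≤2 refl (trans (shortfall-lower v (fromℕ n) (fromℕ n) ℕ.≤-refl) (low-corner lower))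
    where
    open Code code
    shortfall≤2 : ∀ i j → shortfall v i j ℕ.≤ 2
    shortfall≤2 i j with ℕ.≤-total (toℕ j) (toℕ i)
    ... | inj₁ j≤i = subst (ℕ._≤ 2) (sym (shortfall-lower v i j j≤i)) (low≤2 (Vec.map proj₁ v) i j)
    ... | inj₂ i≤j = subst (ℕ._≤ 2) (sym (shortfall-upper v level j i i≤j)) (low≤2 (Vec.map proj₂ v) j i)

  zip-projections : ∀ {n} (v : Vec State n) → Vec.zip (Vec.map proj₁ v) (Vec.map proj₂ v) ≡ v
  zip-projections []      = refl
  zip-projections (s ∷ v) = cong (s ∷_) (zip-projections v)

  decode-injective : ∀ {n} {v w : Vec State (suc n)} → Code v → Code w → decode v ≡ decode w → v ≡ w
  decode-injective {v = v} {w} code code′ eq = begin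
    v                                             ≡⟨ zip-projections v ⟨
    Vec.zip (Vec.map proj₁ v) (Vec.map proj₂ v)   ≡⟨ cong₂ Vec.zip lower≡ upper≡ ⟩
    Vec.zip (Vec.map proj₁ w) (Vec.map proj₂ w)   ≡⟨ zip-projections w ⟩
    w                                             ∎
    where
    module V = Code code
    module W = Code code′
    shortfall≡ : ∀ i j → shortfall v i j ≡ shortfall w i j
    shortfall≡ i j = ℤ.+-injective (cancel-top (+ (toℕ i ⊔ toℕ j))
      (trans (sym (decode-deficit v i j)) (trans (cong (λ x → entry x i j) eq) (decode-deficit w i j))))
    lower≡ : Vec.map proj₁ v ≡ Vec.map proj₁ w
    lower≡ = low-injective V.lower W.lower λ i j j≤i →
      trans (sym (shortfall-lower v i j j≤i)) (trans (shortfall≡ i j) (shortfall-lower w i j j≤i))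
    upper≡ : Vec.map proj₂ v ≡ Vec.map proj₂ w
    upper≡ = low-injective V.upper W.upper λ j i i≤j →
      trans (sym (shortfall-upper v V.level j i i≤j)) (trans (shortfall≡ i j) (shortfall-upper w W.level j i i≤j))

  decode-surjective : ∀ {n} {x : Array (suc n) (suc n)} → Legal 2 (suc n) (suc n) x →
                      ∃ λ v → Code v × Complete v × x ≡ decode v
  decode-surjective {n} {x} legal
    with low-surjective n d (local⇒triangle (entry x) d deficit rules) (deficitOf≤2 legal) (deficitOf-end legal)
       | low-surjective n (flip d)
           (local⇒triangle (flip (entry x)) (flip d) (transpose-deficit (entry x) d deficit) (transpose rules))
           (flip (deficitOf≤2 legal)) (deficitOf-end legal)
    where
    d = deficitOf legal
    deficit = legal⇒deficit legal
    rules = legal⇒local legal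
  ... | _ , hs , lower , d≗hs | _ , ks , upper , d≗ks = v , code , complete , array-ext entries
    where
    d = deficitOf legal
    v : Vec State (suc n)
    v = Vec.zip hs ks
    hs≡ : Vec.map proj₁ v ≡ hs
    hs≡ = Vec.map-proj₁-zip hs ks
    ks≡ : Vec.map proj₂ v ≡ ks
    ks≡ = Vec.map-proj₂-zip hs ks
    heads : ∀ i → head (lookup hs i) ≡ head (lookup ks i)
    heads i = trans (sym (low-diag hs i)) (trans (sym (d≗hs i i ℕ.≤-refl)) (trans (d≗ks i i ℕ.≤-refl) (low-diag ks i)))
    level : ∀ i → head (proj₁ (lookup v i)) ≡ head (proj₂ (lookup v i))
    level i = subst (λ s → head (proj₁ s) ≡ head (proj₂ s)) (sym (Vec.lookup-zip i hs ks)) (heads i)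
    code : Code v
    code = record { lower = subst Triangle (sym hs≡) lower ; upper = subst Triangle (sym ks≡) upper ; level = level }
    first : ∀ {n} (hs ks : Vec Word (suc n)) → head (proj₁ (Vec.head (Vec.zip hs ks))) ≡ low hs zero zero
    first (_ ∷ _) (_ ∷ _) = refl
    complete : Complete v
    complete = trans (first hs ks) (trans (sym (d≗hs zero zero z≤n)) (deficitOf-start legal))
    d≗shortfall : ∀ i j → d i j ≡ shortfall v i j
    d≗shortfall i j with ℕ.≤-total (toℕ j) (toℕ i)
    ... | inj₁ j≤i = trans (d≗hs i j j≤i)
      (trans (cong (λ ws → low ws i j) (sym hs≡)) (sym (shortfall-lower v i j j≤i)))
    ... | inj₂ i≤j = trans (d≗ks j i i≤j)
      (trans (cong (λ ws → low ws j i) (sym ks≡)) (sym (shortfall-upper v level j i i≤j)))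
    entries : ∀ i j → entry x i j ≡ entry (decode v) i j
    entries i j = trans (legal⇒deficit legal i j)
      (trans (cong (λ y → + (toℕ i ⊔ toℕ j) - + y) (d≗shortfall i j)) (sym (decode-deficit v i j)))

  -- Equality of the counts

  unique-map : ∀ {A B : Set} (g : A → B) {xs : List A} →
    (∀ {x y} → x ∈ xs → y ∈ xs → g x ≡ g y → x ≡ y) → Unique xs → Unique (map g xs)
  unique-map g inj []       = []
  unique-map g inj (p ∷ ps) =
    All.map⁺ (All.tabulate λ y∈ eq → All.lookup p y∈ (inj (here refl) (there y∈) eq))
    ∷ unique-map g (λ x∈ y∈ → inj (there x∈) (there y∈)) ps

  -- Two duplicate-free lists with the same members are permutations of each other, so the
  -- exhaustive list of arrays is as long as the list of decoded codes. As `decode` is injective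
  -- only on codes, uniqueness uses injectivity relative to the list.
  f-suc : ∀ n → f (suc n) ≡ extensions n (w₂ , w₂)
  f-suc n = begin
    length (legalArrays 2 (suc n) (suc n))
      ≡⟨ ↭-length (∼bag⇒↭ (unique∧set⇒bag (legalArrays-unique 2 (suc n) (suc n)) decoded-unique
           (decoded ⇔-∘ ∈-legalArrays 2 (suc n) (suc n) _))) ⟩
    length (map decode complete)
      ≡⟨ length-map decode complete ⟩
    length complete
      ≡⟨ complete-count (codes n) ⟩
    sum (map (λ v → extensions 0 (Vec.head v)) (codes n))
      ≡⟨ extensions-codes n 0 ⟩
    extensions (n ℕ.+ 0) (w₂ , w₂)
      ≡⟨ cong (λ m → extensions m (w₂ , w₂)) (ℕ.+-identityʳ n) ⟩
    extensions n (w₂ , w₂) ∎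
    where
    complete : List (Vec State (suc n))
    complete = filter complete? (codes n)
    decoded-unique : Unique (map decode complete)
    decoded-unique = unique-map decode
      (λ v∈ w∈ → decode-injective (∈-codes⁻ n (proj₁ (∈.∈-filter⁻ complete? v∈)))
                                  (∈-codes⁻ n (proj₁ (∈.∈-filter⁻ complete? w∈))))
      (Unique.filter⁺ complete? (codes-unique n))
    decoded : ∀ {x} → Legal 2 (suc n) (suc n) x ⇔ x ∈ map decode complete
    decoded = mk⇔
      (λ legal → let v , code , complete , x≡ = decode-surjective legal in
        subst (_∈ _) (sym x≡) (∈.∈-map⁺ decode (∈.∈-filter⁺ complete? (∈-codes⁺ n code) complete)))
      (λ x∈ → let v , v∈ , x≡ = ∈.∈-map⁻ decode x∈ ; v∈codes , v-complete = ∈.∈-filter⁻ complete? v∈ in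
        subst (Legal 2 (suc n) (suc n)) (sym x≡) (decode-legal (∈-codes⁻ n v∈codes) v-complete))

  f-S : ∀ n → + f (suc n) ≡ S n
  f-S n = trans (cong +_ (f-suc n)) (extensions-S n)

  -- The recurrence

  horner : ∀ {k} → List ℤ → Polynomial k → Polynomial k
  horner []       x = con 0ℤ
  horner (c ∷ cs) x = con c :+ x :* horner cs x

  -- Polymorphic in the number of variables: one term serves both in the solver's identity in 14
  -- variables and, through `⟦_⟧₁`, as a function of n alone.
  c₀ c₁ c₂ c₃ c₄ c₅ : ∀ {k} → Polynomial k → Polynomial k
  c₀ n = con (+ 32) :* (n :+ con (+ 1)) :* (con (+ 2) :* n :+ con (+ 1)) :^ 2 :* (con (+ 1575)
         :* n :^ 6 :+ con (+ 21285) :* n :^ 5 :+ con (+ 117954) :* n :^ 4 :+ con (+ 343020)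
         :* n :^ 3 :+ con (+ 551943) :* n :^ 2 :+ con (+ 465785) :* n :+ con (+ 161046))
  c₁ n = con (+ 8) :* (con (+ 121275) :* n :^ 9 :+ con (+ 1933470) :* n :^ 8
         :+ con (+ 13267683) :* n :^ 7 :+ con (+ 51280818) :* n :^ 6 :+ con (+ 122556360) :* n
         :^ 5 :+ con (+ 186866686) :* n :^ 4 :+ con (+ 180574335) :* n :^ 3
         :+ con (+ 105734340) :* n :^ 2 :+ con (+ 33718283) :* n :+ con (+ 4443102))
  c₂ n = con (+ 2) :* (con (+ 294525) :* n :^ 9 :+ con (+ 4763070) :* n :^ 8
         :+ con (+ 33170868) :* n :^ 7 :+ con (+ 130145646) :* n :^ 6 :+ con (+ 315713355) :* n
         :^ 5 :+ con (+ 488415476) :* n :^ 4 :+ con (+ 478464380) :* n :^ 3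
         :+ con (+ 283626704) :* n :^ 2 :+ con (+ 91378536) :* n :+ con (+ 12137328))
  c₃ n = (con (+ 294525) :* n :^ 9 :+ con (+ 4668570) :* n :^ 8 :+ con (+ 31877118) :* n :^ 7
         :+ con (+ 122735586) :* n :^ 6 :+ con (+ 292620525) :* n :^ 5 :+ con (+ 445804136)
         :* n :^ 4 :+ con (+ 431097970) :* n :^ 3 :+ con (+ 252913504) :* n :^ 2
         :+ con (+ 80866406) :* n :+ con (+ 10688508))
  c₄ n = (con (+ 121275) :* n :^ 9 :+ con (+ 1961820) :* n :^ 8 :+ con (+ 13655808) :* n :^ 7
         :+ con (+ 53503836) :* n :^ 6 :+ con (+ 129484209) :* n :^ 5 :+ con (+ 199650088) :* n
         :^ 4 :+ con (+ 194784258) :* n :^ 3 :+ con (+ 114948300) :* n :^ 2 :+ con (+ 36871922)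
         :* n :+ con (+ 4877748))
  c₅ n = con (+ 2) :* (con (+ 2) :* n :+ con (+ 7)) :* (con (+ 1575) :* n :^ 6 :+ con (+ 11835)
         :* n :^ 5 :+ con (+ 35154) :* n :^ 4 :+ con (+ 52554) :* n :^ 3 :+ con (+ 41382) :* n
         :^ 2 :+ con (+ 16118) :* n :+ con (+ 2428)) :* (n :+ con (+ 3)) :^ 2

  -- The multipliers exhibiting the recurrence of S as a consequence of those of Q, R
  -- and Y at three successive arguments; they arise by eliminating in turn P, Q, R, Y.
  g₀ g₁ g₂ k₀ k₁ k₂ l₀ l₁ : ∀ {k} → Polynomial k → Polynomial k
  g₀ = horner (
      + 1288368 ∷ + 10168120 ∷ + 33353888 ∷ + 59785592 ∷ + 64893904 ∷ + 44503896 ∷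
      + 19389696 ∷ + 5199768 ∷ + 781920 ∷ + 50400 ∷ [])
  g₁ = horner (
      - (+ 7919928) ∷ - (+ 59810476) ∷ - (+ 186453264) ∷ - (+ 316309476) ∷
      - (+ 325062944) ∷ - (+ 211734798) ∷ - (+ 88019364) ∷ - (+ 22635540) ∷
      - (+ 3280500) ∷ - (+ 204750) ∷ [])
  g₂ = horner (
      + 611856 ∷ + 4644456 ∷ + 14481112 ∷ + 24419680 ∷ + 24745744 ∷ + 15744540 ∷
      + 6329436 ∷ + 1558692 ∷ + 214380 ∷ + 12600 ∷ [])
  k₀ = horner (
      - (+ 2576736) ∷ - (+ 17759504) ∷ - (+ 48948272) ∷ - (+ 70622912) ∷
      - (+ 59164896) ∷ - (+ 29842896) ∷ - (+ 8936496) ∷ - (+ 1463040) ∷ - (+ 100800) ∷ [])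
  k₁ = horner (
      + 511812 ∷ + 3664616 ∷ + 10595604 ∷ + 16192792 ∷ + 14449512 ∷ + 7777536 ∷
      + 2482740 ∷ + 432000 ∷ + 31500 ∷ [])
  k₂ = horner (
      - (+ 21852) ∷ - (+ 159630) ∷ - (+ 471574) ∷ - (+ 737396) ∷ - (+ 673092) ∷
      - (+ 369993) ∷ - (+ 120339) ∷ - (+ 21285) ∷ - (+ 1575) ∷ [])
  l₀ = horner (
      - (+ 3865104) ∷ - (+ 29860176) ∷ - (+ 96588064) ∷ - (+ 171524878) ∷
      - (+ 184995492) ∷ - (+ 126298014) ∷ - (+ 54846288) ∷ - (+ 14672430) ∷
      - (+ 2202300) ∷ - (+ 141750) ∷ [])
  l₁ = horner (
      + 2063800 ∷ + 16060316 ∷ + 51727616 ∷ + 90886534 ∷ + 96793128 ∷ + 65273838 ∷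
      + 28038510 ∷ + 7432605 ∷ + 1107450 ∷ + 70875 ∷ [])

  -- The defects repeat the relations of `Q`, `R` and `Y` as differences of their sides, so that
  -- they evaluate to the shape `x - y` on which `vanish` acts.
  QDefect : ∀ {k} (n q q′ r y : Polynomial k) → Polynomial k
  QDefect n q q′ r y = con (+ 4) :* q :+ con (+ 2) :* q′ :+ con (+ 3) :* r :- (con (+ 3) :* n :+ con (+ 2)) :* n :* y

  RDefect : ∀ {k} (n r r′ y : Polynomial k) → Polynomial k
  RDefect n r r′ y = (n :+ con 1ℤ) :* r :- con (+ 2) :* (con (+ 2) :* n :+ con (+ 3)) :* r′ :-
    (:- ((n :+ con 1ℤ) :* (con (+ 21) :* (n :* n) :+ con (+ 22) :* n :+ con (+ 6)) :* y))

  YDefect : ∀ {k} (n y y′ : Polynomial k) → Polynomial k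
  YDefect n y y′ = (n :+ con (+ 2)) :* (n :+ con (+ 2)) :* y′ :-
    con (+ 4) :* (con (+ 2) :* n :+ con 1ℤ) :* (con (+ 2) :* n :+ con 1ℤ) :* y

  ⟦_⟧₁ : (∀ {k} → Polynomial k → Polynomial k) → ℤ → ℤ
  ⟦ p ⟧₁ x = ⟦ p (var {1} zero) ⟧ (x ∷ [])

  vanish : ∀ k {x y} → x ≡ y → k * (x - y) ≡ 0ℤ
  vanish k {x} refl = trans (cong (λ z → k * z) (ℤ.+-inverseʳ x)) (ℤ.*-zeroʳ k)

  infixl 5 _⊞_

  _⊞_ : ∀ {x y} → x ≡ 0ℤ → y ≡ 0ℤ → x + y ≡ 0ℤ
  _⊞_ = cong₂ _+_

  -- Arbitrary integers stand for the values of the sequences. The recurrences of s and p are solved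
  -- for the next value and are substituted away; those of q, r and y have leading coefficients
  -- other than 1, so they enter as defects times multipliers.
  combination : ∀ n {s₀ s₁ s₂ s₃ s₄ s₅ p₀ p₁ p₂ p₃ p₄ q₀ q₁ q₂ q₃ r₀ r₁ r₂ r₃ y₀ y₁ y₂} →
    s₁ ≡ s₀ + p₀ → s₂ ≡ s₁ + p₁ → s₃ ≡ s₂ + p₂ → s₄ ≡ s₃ + p₃ → s₅ ≡ s₄ + p₄ →
    p₁ ≡ + 4 * p₀ + + 4 * q₀ + r₀ → p₂ ≡ + 4 * p₁ + + 4 * q₁ + r₁ →
    p₃ ≡ + 4 * p₂ + + 4 * q₂ + r₂ → p₄ ≡ + 4 * p₃ + + 4 * q₃ + r₃ →
    QRelation n q₀ q₁ r₀ y₀ → QRelation (1ℤ + n) q₁ q₂ r₁ y₁ → QRelation (+ 2 + n) q₂ q₃ r₂ y₂ →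
    RRelation n r₀ r₁ y₀ → RRelation (1ℤ + n) r₁ r₂ y₁ → RRelation (+ 2 + n) r₂ r₃ y₂ →
    YRelation n y₀ y₁ → YRelation (1ℤ + n) y₁ y₂ →
    ⟦ c₀ ⟧₁ n * s₀ - ⟦ c₁ ⟧₁ n * s₁ + ⟦ c₂ ⟧₁ n * s₂ + ⟦ c₃ ⟧₁ n * s₃ - ⟦ c₄ ⟧₁ n * s₄ + ⟦ c₅ ⟧₁ n * s₅ ≡ 0ℤ
  combination n {s₀ = s₀} {p₀ = p₀} {q₀ = q₀} {q₁} {q₂} {q₃} {r₀} {r₁} {r₂} {r₃} {y₀} {y₁} {y₂}
    refl refl refl refl refl refl refl refl refl eq₀ eq₁ eq₂ er₀ er₁ er₂ ey₀ ey₁ =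
    trans (identity s₀ p₀ q₀ q₁ q₂ q₃ r₀ r₁ r₂ r₃ y₀ y₁ y₂ n)
      (vanish (⟦ g₀ ⟧₁ n) eq₀ ⊞ vanish (⟦ g₁ ⟧₁ n) eq₁ ⊞ vanish (⟦ g₂ ⟧₁ n) eq₂
       ⊞ vanish (⟦ k₀ ⟧₁ n) er₀ ⊞ vanish (⟦ k₁ ⟧₁ n) er₁ ⊞ vanish (⟦ k₂ ⟧₁ n) er₂
       ⊞ vanish (⟦ l₀ ⟧₁ n) ey₀ ⊞ vanish (⟦ l₁ ⟧₁ n) ey₁)
    where
    -- With n as the last variable the solver's normal forms are polynomials in n at
    -- the innermost level; other orders are much slower.
    identity = solve 14 (λ s₀ p₀ q₀ q₁ q₂ q₃ r₀ r₁ r₂ r₃ y₀ y₁ y₂ n →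
      let p₁ = con (+ 4) :* p₀ :+ con (+ 4) :* q₀ :+ r₀
          p₂ = con (+ 4) :* p₁ :+ con (+ 4) :* q₁ :+ r₁
          p₃ = con (+ 4) :* p₂ :+ con (+ 4) :* q₂ :+ r₂
          p₄ = con (+ 4) :* p₃ :+ con (+ 4) :* q₃ :+ r₃
          s₁ = s₀ :+ p₀
          s₂ = s₁ :+ p₁
          s₃ = s₂ :+ p₂
          s₄ = s₃ :+ p₃
          s₅ = s₄ :+ p₄
          n₁ = con 1ℤ :+ n
          n₂ = con (+ 2) :+ n
      in c₀ n :* s₀ :- c₁ n :* s₁ :+ c₂ n :* s₂ :+ c₃ n :* s₃ :- c₄ n :* s₄ :+ c₅ n :* s₅ :=
         g₀ n :* QDefect n q₀ q₁ r₀ y₀ :+ g₁ n :* QDefect n₁ q₁ q₂ r₁ y₁ :+ g₂ n :* QDefect n₂ q₂ q₃ r₂ y₂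
         :+ k₀ n :* RDefect n r₀ r₁ y₀ :+ k₁ n :* RDefect n₁ r₁ r₂ y₁ :+ k₂ n :* RDefect n₂ r₂ r₃ y₂
         :+ l₀ n :* YDefect n y₀ y₁ :+ l₁ n :* YDefect n₁ y₁ y₂)
      refl

  S-recurrence : ∀ m → let n = + suc m in
    ⟦ c₀ ⟧₁ n * S m - ⟦ c₁ ⟧₁ n * S (1 ℕ.+ m) + ⟦ c₂ ⟧₁ n * S (2 ℕ.+ m) + ⟦ c₃ ⟧₁ n * S (3 ℕ.+ m)
      - ⟦ c₄ ⟧₁ n * S (4 ℕ.+ m) + ⟦ c₅ ⟧₁ n * S (5 ℕ.+ m) ≡ 0ℤ
  S-recurrence m = combination (+ suc m)
    {S m} {S (1 ℕ.+ m)} {S (2 ℕ.+ m)} {S (3 ℕ.+ m)} {S (4 ℕ.+ m)} {S (5 ℕ.+ m)}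
    {P m} {P (1 ℕ.+ m)} {P (2 ℕ.+ m)} {P (3 ℕ.+ m)} {P (4 ℕ.+ m)}
    {Q m} {Q (1 ℕ.+ m)} {Q (2 ℕ.+ m)} {Q (3 ℕ.+ m)}
    {R m} {R (1 ℕ.+ m)} {R (2 ℕ.+ m)} {R (3 ℕ.+ m)}
    {Y m} {Y (1 ℕ.+ m)} {Y (2 ℕ.+ m)}
    refl refl refl refl refl
    (P-rec m) (P-rec (1 ℕ.+ m)) (P-rec (2 ℕ.+ m)) (P-rec (3 ℕ.+ m))
    (Q-rec m) (Q-rec (1 ℕ.+ m)) (Q-rec (2 ℕ.+ m))
    (R-rec m) (R-rec (1 ℕ.+ m)) (R-rec (2 ℕ.+ m))
    (Y-rec m) (Y-rec (1 ℕ.+ m))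

  -- Casting the coefficients from naturals to integers

  infixl 6 _⊕_
  infixl 7 _⊗_
  infixr 8 _⊛_

  lit : ∀ a → + a ≡ + a
  lit a = refl

  _⊕_ : ∀ {a b x y} → + a ≡ x → + b ≡ y → + (a ℕ.+ b) ≡ x + y
  refl ⊕ refl = refl

  _⊗_ : ∀ {a b x y} → + a ≡ x → + b ≡ y → + (a ℕ.* b) ≡ x * y
  _⊗_ {a} {b} refl refl = ℤ.pos-* a b

  -- The target is the solver's own evaluation of a power, so that a proof composed along the shape
  -- of a coefficient has `⟦_⟧₁` of the polynomial as its right-hand side by computation.
  _⊛_ : ∀ {a x} → + a ≡ x → ∀ k → + (a ℕ.^ k) ≡ ⟦ var {1} zero :^ k ⟧ (x ∷ [])
  e    ⊛ zero  = refl
  _⊛_ {a} refl (suc k) = trans (ℤ.pos-* a (a ℕ.^ k)) (cong (λ y → + a * y) (_⊛_ {a} refl k))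

open Proof
open import Data.Nat using (_+_; _*_; _^_; _≥_)

-- As n and x are variables here, Agda does not unfold products with large literals.
coeff₀ : ∀ n {x} → + n ≡ x → + (
      32 * (n + 1) * (2 * n + 1) ^ 2 * (1575 * n ^ 6 + 21285 * n ^ 5 + 117954 * n ^ 4
      + 343020 * n ^ 3 + 551943 * n ^ 2 + 465785 * n + 161046))
    ≡ ⟦ c₀ ⟧₁ x
coeff₀ _ n = lit 32 ⊗ (n ⊕ lit 1) ⊗ (lit 2 ⊗ n ⊕ lit 1) ⊛ 2 ⊗ (lit 1575 ⊗ n ⊛ 6 ⊕ lit 21285
         ⊗ n ⊛ 5 ⊕ lit 117954 ⊗ n ⊛ 4 ⊕ lit 343020 ⊗ n ⊛ 3 ⊕ lit 551943 ⊗ n ⊛ 2 ⊕ lit 465785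
         ⊗ n ⊕ lit 161046)

coeff₁ : ∀ n {x} → + n ≡ x → + (
      8 * (121275 * n ^ 9 + 1933470 * n ^ 8 + 13267683 * n ^ 7 + 51280818 * n ^ 6
      + 122556360 * n ^ 5 + 186866686 * n ^ 4 + 180574335 * n ^ 3 + 105734340 * n ^ 2
      + 33718283 * n + 4443102))
    ≡ ⟦ c₁ ⟧₁ x
coeff₁ _ n = lit 8 ⊗ (lit 121275 ⊗ n ⊛ 9 ⊕ lit 1933470 ⊗ n ⊛ 8 ⊕ lit 13267683 ⊗ n ⊛ 7
         ⊕ lit 51280818 ⊗ n ⊛ 6 ⊕ lit 122556360 ⊗ n ⊛ 5 ⊕ lit 186866686 ⊗ n ⊛ 4
         ⊕ lit 180574335 ⊗ n ⊛ 3 ⊕ lit 105734340 ⊗ n ⊛ 2 ⊕ lit 33718283 ⊗ n ⊕ lit 4443102)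

coeff₂ : ∀ n {x} → + n ≡ x → + (
      2 * (294525 * n ^ 9 + 4763070 * n ^ 8 + 33170868 * n ^ 7 + 130145646 * n ^ 6
      + 315713355 * n ^ 5 + 488415476 * n ^ 4 + 478464380 * n ^ 3 + 283626704 * n ^ 2
      + 91378536 * n + 12137328))
    ≡ ⟦ c₂ ⟧₁ x
coeff₂ _ n = lit 2 ⊗ (lit 294525 ⊗ n ⊛ 9 ⊕ lit 4763070 ⊗ n ⊛ 8 ⊕ lit 33170868 ⊗ n ⊛ 7
         ⊕ lit 130145646 ⊗ n ⊛ 6 ⊕ lit 315713355 ⊗ n ⊛ 5 ⊕ lit 488415476 ⊗ n ⊛ 4
         ⊕ lit 478464380 ⊗ n ⊛ 3 ⊕ lit 283626704 ⊗ n ⊛ 2 ⊕ lit 91378536 ⊗ n ⊕ lit 12137328)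

coeff₃ : ∀ n {x} → + n ≡ x → + (
      (294525 * n ^ 9 + 4668570 * n ^ 8 + 31877118 * n ^ 7 + 122735586 * n ^ 6 + 292620525
      * n ^ 5 + 445804136 * n ^ 4 + 431097970 * n ^ 3 + 252913504 * n ^ 2 + 80866406 * n
      + 10688508))
    ≡ ⟦ c₃ ⟧₁ x
coeff₃ _ n = (lit 294525 ⊗ n ⊛ 9 ⊕ lit 4668570 ⊗ n ⊛ 8 ⊕ lit 31877118 ⊗ n ⊛ 7 ⊕ lit 122735586
         ⊗ n ⊛ 6 ⊕ lit 292620525 ⊗ n ⊛ 5 ⊕ lit 445804136 ⊗ n ⊛ 4 ⊕ lit 431097970 ⊗ n ⊛ 3
         ⊕ lit 252913504 ⊗ n ⊛ 2 ⊕ lit 80866406 ⊗ n ⊕ lit 10688508)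

coeff₄ : ∀ n {x} → + n ≡ x → + (
      (121275 * n ^ 9 + 1961820 * n ^ 8 + 13655808 * n ^ 7 + 53503836 * n ^ 6 + 129484209
      * n ^ 5 + 199650088 * n ^ 4 + 194784258 * n ^ 3 + 114948300 * n ^ 2 + 36871922 * n
      + 4877748))
    ≡ ⟦ c₄ ⟧₁ x
coeff₄ _ n = (lit 121275 ⊗ n ⊛ 9 ⊕ lit 1961820 ⊗ n ⊛ 8 ⊕ lit 13655808 ⊗ n ⊛ 7 ⊕ lit 53503836
         ⊗ n ⊛ 6 ⊕ lit 129484209 ⊗ n ⊛ 5 ⊕ lit 199650088 ⊗ n ⊛ 4 ⊕ lit 194784258 ⊗ n ⊛ 3
         ⊕ lit 114948300 ⊗ n ⊛ 2 ⊕ lit 36871922 ⊗ n ⊕ lit 4877748)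

coeff₅ : ∀ n {x} → + n ≡ x → + (
      2 * (2 * n + 7) * (1575 * n ^ 6 + 11835 * n ^ 5 + 35154 * n ^ 4 + 52554 * n ^ 3
      + 41382 * n ^ 2 + 16118 * n + 2428) * (n + 3) ^ 2)
    ≡ ⟦ c₅ ⟧₁ x
coeff₅ _ n = lit 2 ⊗ (lit 2 ⊗ n ⊕ lit 7) ⊗ (lit 1575 ⊗ n ⊛ 6 ⊕ lit 11835 ⊗ n ⊛ 5 ⊕ lit 35154
         ⊗ n ⊛ 4 ⊕ lit 52554 ⊗ n ⊛ 3 ⊕ lit 41382 ⊗ n ⊛ 2 ⊕ lit 16118 ⊗ n ⊕ lit 2428) ⊗ (n
         ⊕ lit 3) ⊛ 2

mainTheorem4 : ∀ (n : ℕ) → n ≥ 1 →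
    + (32 * (n + 1) * (2 * n + 1) ^ 2
        * (1575 * n ^ 6 + 21285 * n ^ 5 + 117954 * n ^ 4 + 343020 * n ^ 3
           + 551943 * n ^ 2 + 465785 * n + 161046) * f n)
    ℤ.- + (8
        * (121275 * n ^ 9 + 1933470 * n ^ 8 + 13267683 * n ^ 7 + 51280818 * n ^ 6
           + 122556360 * n ^ 5 + 186866686 * n ^ 4 + 180574335 * n ^ 3
           + 105734340 * n ^ 2 + 33718283 * n + 4443102) * f (n + 1))
    ℤ.+ + (2
        * (294525 * n ^ 9 + 4763070 * n ^ 8 + 33170868 * n ^ 7 + 130145646 * n ^ 6
           + 315713355 * n ^ 5 + 488415476 * n ^ 4 + 478464380 * n ^ 3
           + 283626704 * n ^ 2 + 91378536 * n + 12137328) * f (n + 2))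
    ℤ.+ + ((294525 * n ^ 9 + 4668570 * n ^ 8 + 31877118 * n ^ 7 + 122735586 * n ^ 6
           + 292620525 * n ^ 5 + 445804136 * n ^ 4 + 431097970 * n ^ 3
           + 252913504 * n ^ 2 + 80866406 * n + 10688508) * f (n + 3))
    ℤ.- + ((121275 * n ^ 9 + 1961820 * n ^ 8 + 13655808 * n ^ 7 + 53503836 * n ^ 6
           + 129484209 * n ^ 5 + 199650088 * n ^ 4 + 194784258 * n ^ 3
           + 114948300 * n ^ 2 + 36871922 * n + 4877748) * f (n + 4))
    ℤ.+ + (2 * (2 * n + 7)
        * (1575 * n ^ 6 + 11835 * n ^ 5 + 35154 * n ^ 4 + 52554 * n ^ 3
           + 41382 * n ^ 2 + 16118 * n + 2428) * (n + 3) ^ 2 * f (n + 5))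
    ≡ + 0
mainTheorem4 n n≥1 = trans sums (S-recurrence m)
  where
  m : ℕ
  m = ℕ.pred n
  n≡1+m : n ≡ suc m
  n≡1+m = sym (ℕ.suc-pred n ⦃ ℕ.>-nonZero n≥1 ⦄)
  n≡ : + n ≡ + suc m
  n≡ = cong +_ n≡1+m
  value₀ : + f n ≡ S m
  value₀ = trans (cong (λ l → + f l) n≡1+m) (f-S m)
  value : ∀ k → + f (n + k) ≡ S (k + m)
  value k = trans (cong (λ l → + f l) (trans (cong (_+ k) n≡1+m) (cong suc (ℕ.+-comm m k)))) (f-S (k + m))
  sums = cong₂ ℤ._+_ (cong₂ ℤ._-_ (cong₂ ℤ._+_ (cong₂ ℤ._+_ (cong₂ ℤ._-_
    (coeff₀ n n≡ ⊗ value₀) (coeff₁ n n≡ ⊗ value 1)) (coeff₂ n n≡ ⊗ value 2)) (coeff₃ n n≡ ⊗ value 3))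
    (coeff₄ n n≡ ⊗ value 4)) (coeff₅ n n≡ ⊗ value 5)
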